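{- Let $b\ge 2$, $n\ge 2$, and let $P$ be the $n\times n$ matrix $P(i,j)=\mathbb{P}\{jb\le i+X_1+\cdots+X_n\le (j+1)b-1\}$, $0\le i,j\le n-1$, with $X_1,\dots,X_n$ independent uniform on $\{0,\dots,b-1\}$. Let $\pi(j)=A(n,j)/n!$, where $A(n,j)$ is the number of permutations in $S_n$ with exactly $j$ descents, and define the separation distance $\mathrm{sep}(r)=\max_{0\le j\le n-1}\left[1-\frac{P^r(0,j)}{\pi(j)}\right]$. Then: (1) for all $r\ge 0$, the maximum defining $\mathrm{sep}(r)$ is attained at $j=n-1$; (2) for $r=2\log_b(n)+\log_b(c)$ with $c>0$ fixed, $\mathrm{sep}(r)\to 1-e^{ -1/(2c)}$ as $n\to\infty$.
   Context: $P$ is the transition matrix of the carries chain when $n$ random base-$b$ numbers are added (started at carry $0$), and $\pi$ is its stationary distribution. A permutation $\sigma$ has a descent at $i$ if $\sigma(i+1)<\sigma(i)$. -}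

module Defs where

open import Data.Nat as ℕ using (ℕ; zero; suc; _≤?_; _<?_; _≟_)
open import Data.Integer using (+_)
open import Data.Rational as ℚ using (ℚ; 0ℚ; 1ℚ; _+_; _*_; _-_; -_; _/_; _⊔_)
open import Data.List using (List; []; _∷_; map; concatMap; filter; length; upTo; foldr)
import Data.List as L
open import Data.Bool using (Bool; true; false; _∧_; not)
open import Relation.Nullary.Decidable using (⌊_⌋; yes; no)
open import Data.Nat.Base using (_!)
open import Data.Nat.ListAction using (sum)

ℕtoℚ : ℕ → ℚ
ℕtoℚ k = (+ k) / 1

-- p / d as a rational (only ever used with d ≠ 0; d = 0 gives 0)
frac : ℕ → ℕ → ℚ
frac p zero = 0ℚ
frac p (suc d) = (+ p) / suc d

Σ< : ℕ → (ℕ → ℚ) → ℚ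
Σ< m f = foldr (λ k acc → f k + acc) 0ℚ (upTo m)

tuples : ℕ → ℕ → List (List ℕ)
tuples b zero = [] ∷ []
tuples b (suc n) = concatMap (λ x → map (x ∷_) (tuples b n)) (upTo b)

-- The carries matrix
-- P(i,j) = Prob{ j b ≤ i + X₁ + ⋯ + Xₙ ≤ (j+1) b - 1 },
-- X₁,…,Xₙ i.i.d. uniform on {0,…,b-1}: the number of tuples
-- (x₁,…,xₙ) ∈ {0..b-1}ⁿ satisfying the condition divided by bⁿ.

inCarryWindow : ℕ → ℕ → ℕ → List ℕ → Bool
inCarryWindow b i j xs =
  ⌊ j ℕ.* b ≤? i ℕ.+ sum xs ⌋ ∧ ⌊ i ℕ.+ sum xs <? (suc j) ℕ.* b ⌋

carriesP : (b n : ℕ) → ℕ → ℕ → ℚ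
carriesP b n i j =
  frac (length (filter (λ xs → Data.Bool._≟_ (inCarryWindow b i j xs) true) (tuples b n)))
       (b ℕ.^ n)
  where import Data.Bool

-- n×n matrices with entries indexed by 0 … n-1, matrix product and powers
Mat : Set
Mat = ℕ → ℕ → ℚ

matMul : ℕ → Mat → Mat → Mat
matMul n A B i j = Σ< n (λ k → A i k * B k j)

idMat : Mat
idMat i j with i ≟ j
... | yes _ = 1ℚ
... | no  _ = 0ℚ

matPow : ℕ → Mat → ℕ → Mat
matPow n A zero = idMat
matPow n A (suc r) = matMul n (matPow n A r) A

-- Permutations of {0,…,n-1} (one-line notation) and descents

notElem : ℕ → List ℕ → Bool
notElem x [] = true
notElem x (y ∷ ys) = not ⌊ x ≟ y ⌋ ∧ notElem x ys

distinct : List ℕ → Bool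
distinct [] = true
distinct (x ∷ xs) = notElem x xs ∧ distinct xs

perms : ℕ → List (List ℕ)
perms n = filter (λ w → Data.Bool._≟_ (distinct w) true) (tuples n n)
  where import Data.Bool

descents : List ℕ → ℕ
descents [] = 0
descents (x ∷ []) = 0
descents (x ∷ y ∷ ys) = (if ⌊ y <? x ⌋ then 1 else 0) ℕ.+ descents (y ∷ ys)
  where open import Data.Bool using (if_then_else_)

eulerian : ℕ → ℕ → ℕ
eulerian n j = length (filter (λ σ → descents σ ≟ j) (perms n))

piDist : ℕ → ℕ → ℚ
piDist n j = frac (eulerian n j) (n !)

-- the term 1 - P^r(0,j)/π(j)  (π(j) > 0 for j ≤ n-1;
-- written as 1 - P^r(0,j) · n!/A(n,j))
sepTerm : (b n r j : ℕ) → ℚ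
sepTerm b n r j = 1ℚ - matPow n (carriesP b n) r 0 j * frac (n !) (eulerian n j)

sep : (b n r : ℕ) → ℚ
sep b n r = foldr (λ j acc → sepTerm b n r j ⊔ acc) (sepTerm b n r 0) (upTo n)

powℚ : ℚ → ℕ → ℚ
powℚ x zero = 1ℚ
powℚ x (suc k) = x * powℚ x k

expPartial : ℕ → ℚ → ℚ
expPartial M x = Σ< M (λ k → powℚ x k * frac 1 (k !))

-- 1/(2c) for a positive rational c = p/q (p > 0):  q/(2p).
-- (Value on non-positive c is irrelevant; it is set to 0.)
invTwice : ℚ → ℚ
invTwice c with ℚ.numerator c
... | Data.Integer.+ suc p = (+ ℚ.denominatorℕ c) / (2 ℕ.* suc p)
... | _ = 0ℚ
  where import Data.Integer

{-# OPTIONS --safe #-}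
-- P(b)^r = P(b^r), by reading the summands in base b^r. With B = b^r and words x₁ … xₙ over {0,…,B-1},
-- passing to partial sums mod B turns the carry of x₁ + ⋯ + xₙ into the number of descents of a word, so
-- Bⁿ P^r(0,j) counts the words with j descents. At least C(B,n) A(n,j) of them have distinct letters, and
-- for j = n-1 all of them do (they are strictly decreasing). Hence P^r(0,j)/π(j) ≥ C(B,n) n!/Bⁿ with
-- equality at j = n-1, and sep(r) = 1 - ∏_{i<n} (1 - i/B).
-- For B = c n², put x = 1/(2c) = n²/(2B). Moving the exponent along the partial sums of i/B, each factor
-- 1 - i/B changes the exponential partial sum by a second-order Taylor remainder, of order (i/B)², plus
-- a tail term; together these errors are O(1/n) + O(1/M).
module Submission where

open import Defs

-- That the letter set of a distinct word does not affect its descents is usually seen by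
-- standardising words to permutations. Here no such bijection is built: a distinct word over a
-- larger alphabet either omits the new top letter or contains it once, so the counts obey Pascal's
-- rule in the alphabet and the Eulerian recurrence in the descents. The alphabet of size `n` then
-- recovers `eulerian` itself. The limit is stated over the rationals, where the value at `- x`
-- exists only through its partial sums. These alternate in sign and obey no exact functional
-- equation, so every estimate takes absolute values, is dominated by the partial sums at the
-- positive point `x`, and must hold uniformly in the truncation `M`. The index `M` therefore enters
-- the error on the same footing as `n`: both contributions are multiplied by one `N` below `n` and
-- `M` and bounded by a constant that depends on `x` alone, which spares all divisions. The
-- second-order remainder is obtained from a recurrence in the degree instead of an integral.

module CarriesAndDescents where

  open import Data.Nat
  open import Data.Nat.Properties
  open import Data.Nat.DivMod
  open import Data.Nat.Divisibility using (n∣m*n)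
  open import Data.Nat.Combinatorics using (_C_; nCn≡1; nCk+nC[k+1]≡[n+1]C[k+1])
  open import Data.Nat.ListAction using (sum)
  open import Data.Nat.ListAction.Properties using (sum-++)
  open import Data.Nat.Tactic.RingSolver using (solve-∀)
  open import Data.Bool using (Bool; true; false; if_then_else_; not; _∧_)
  import Data.Bool as Bool
  open import Data.List using (List; []; _∷_; map; concatMap; filter; length; upTo; applyUpTo; _++_)
  open import Data.List.Properties using (map-++; map-∘; map-upTo)
  open import Data.List.Relation.Unary.All using (All; []; _∷_)
  import Data.List.Relation.Unary.All as All
  open import Data.Product using (_×_; _,_; proj₁)
  open import Function using (_∘_)
  open import Relation.Nullary using (Dec; yes; no; does; ¬_; contradiction)
  open import Relation.Nullary.Decidable using (⌊_⌋; isYes≗does)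
  import Relation.Nullary.Decidable as Dec
  open import Relation.Unary using (Decidable)
  open import Relation.Binary.PropositionalEquality

  -- Indicators and finite sums of natural numbers

  ⌊⌋-yes : ∀ {P : Set} (P? : Dec P) → P → ⌊ P? ⌋ ≡ true
  ⌊⌋-yes P? p = trans (isYes≗does P?) (Dec.dec-true P? p)

  ⌊⌋-no : ∀ {P : Set} (P? : Dec P) → ¬ P → ⌊ P? ⌋ ≡ false
  ⌊⌋-no P? ¬p = trans (isYes≗does P?) (Dec.dec-false P? ¬p)

  ⟦_⟧ : Bool → ℕ
  ⟦ β ⟧ = if β then 1 else 0

  ⟦∧⟧ : ∀ α β → ⟦ α ∧ β ⟧ ≡ ⟦ α ⟧ * ⟦ β ⟧
  ⟦∧⟧ false β = refl
  ⟦∧⟧ true  β = sym (+-identityʳ ⟦ β ⟧)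

  ⟦⟧≤1 : ∀ β → ⟦ β ⟧ ≤ 1
  ⟦⟧≤1 false = z≤n
  ⟦⟧≤1 true  = ≤-refl

  -- Recursion removes the last index, so that the largest letter of the alphabet `suc B` splits off
  -- by definition; `∑-head` supplies the other end, from which `upTo` is built.
  ∑ : ℕ → (ℕ → ℕ) → ℕ
  ∑ zero    f = 0
  ∑ (suc m) f = ∑ m f + f m

  module _ where
    open ≡-Reasoning

    ∑-cong : ∀ m {f g : ℕ → ℕ} → (∀ x → x < m → f x ≡ g x) → ∑ m f ≡ ∑ m g
    ∑-cong zero    h = refl
    ∑-cong (suc m) h = cong₂ _+_ (∑-cong m (λ x x<m → h x (m<n⇒m<1+n x<m))) (h m ≤-refl)

    ∑-mono : ∀ m {f g : ℕ → ℕ} → (∀ x → f x ≤ g x) → ∑ m f ≤ ∑ m g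
    ∑-mono zero    h = z≤n
    ∑-mono (suc m) h = +-mono-≤ (∑-mono m h) (h m)

    ∑-zero : ∀ m → ∑ m (λ _ → 0) ≡ 0
    ∑-zero zero    = refl
    ∑-zero (suc m) = trans (+-identityʳ _) (∑-zero m)

    ∑-+ : ∀ m f g → ∑ m (λ x → f x + g x) ≡ ∑ m f + ∑ m g
    ∑-+ zero    f g = refl
    ∑-+ (suc m) f g = trans (cong (_+ (f m + g m)) (∑-+ m f g)) (interchange (∑ m f) (∑ m g) (f m) (g m))
      where
      interchange : ∀ a b c d → a + b + (c + d) ≡ a + c + (b + d)
      interchange = solve-∀

    ∑-*ˡ : ∀ m k f → ∑ m (λ x → k * f x) ≡ k * ∑ m f
    ∑-*ˡ zero    k f = sym (*-zeroʳ k)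
    ∑-*ˡ (suc m) k f = trans (cong (_+ k * f m) (∑-*ˡ m k f)) (sym (*-distribˡ-+ k (∑ m f) (f m)))

    ∑-swap : ∀ m l (f : ℕ → ℕ → ℕ) → ∑ m (λ x → ∑ l (f x)) ≡ ∑ l (λ y → ∑ m (λ x → f x y))
    ∑-swap zero    l f = sym (∑-zero l)
    ∑-swap (suc m) l f = trans (cong (_+ ∑ l (f m)) (∑-swap m l f)) (sym (∑-+ l _ (f m)))

    ∑-split : ∀ m l f → ∑ (m + l) f ≡ ∑ m f + ∑ l (λ x → f (m + x))
    ∑-split m zero    f = trans (cong (λ k → ∑ k f) (+-identityʳ m)) (sym (+-identityʳ _))
    ∑-split m (suc l) f = begin
      ∑ (m + suc l) f                                 ≡⟨ cong (λ k → ∑ k f) (+-suc m l) ⟩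
      ∑ (m + l) f + f (m + l)                         ≡⟨ cong (_+ f (m + l)) (∑-split m l f) ⟩
      ∑ m f + ∑ l (λ x → f (m + x)) + f (m + l)       ≡⟨ +-assoc (∑ m f) _ _ ⟩
      ∑ m f + ∑ (suc l) (λ x → f (m + x))             ∎

    -- Division with remainder: an index below `b * B` is `x + z * B` for exactly one low digit
    -- `x < B` and one high digit `z < b`.
    ∑-digits : ∀ B b f → ∑ (b * B) f ≡ ∑ B (λ x → ∑ b (λ z → f (x + z * B)))
    ∑-digits B zero    f = sym (∑-zero B)
    ∑-digits B (suc b) f = begin
      ∑ (B + b * B) f                                       ≡⟨ cong (λ k → ∑ k f) (+-comm B (b * B)) ⟩
      ∑ (b * B + B) f                                       ≡⟨ ∑-split (b * B) B f ⟩
      ∑ (b * B) f + ∑ B (λ x → f (b * B + x))               ≡⟨ cong₂ _+_ (∑-digits B b f) (∑-cong B (λ x _ → cong f (+-comm (b * B) x))) ⟩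
      ∑ B (λ x → ∑ b (λ z → f (x + z * B))) + ∑ B (λ x → f (x + b * B))
                                                            ≡⟨ sym (∑-+ B _ _) ⟩
      ∑ B (λ x → ∑ (suc b) (λ z → f (x + z * B)))           ∎

    ∑-head : ∀ m f → ∑ (suc m) f ≡ f 0 + ∑ m (f ∘ suc)
    ∑-head zero    f = sym (+-identityʳ (f 0))
    ∑-head (suc m) f = trans (cong (_+ f (suc m)) (∑-head m f)) (+-assoc (f 0) _ _)

    -- Read from right to left, this introduces the intermediate carry as a summation index, the
    -- form that a matrix product requires.
    ∑-delta : ∀ m l (f : ℕ → ℕ) → l < m → ∑ m (λ k → ⟦ ⌊ l ≟ k ⌋ ⟧ * f k) ≡ f l
    ∑-delta (suc m) l f l<1+m with l ≟ m
    ... | yes refl = begin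
      ∑ m (λ k → ⟦ ⌊ l ≟ k ⌋ ⟧ * f k) + 1 * f l   ≡⟨ cong₂ _+_ (∑-cong m (λ k k<m → cong (λ β → ⟦ β ⟧ * f k) (⌊⌋-no (l ≟ k) (>⇒≢ k<m)))) (*-identityˡ (f l)) ⟩
      ∑ m (λ k → 0) + f l                         ≡⟨ cong (_+ f l) (∑-zero m) ⟩
      f l                                         ∎
    ... | no l≢m = trans (+-identityʳ _) (∑-delta m l f (≤∧≢⇒< (s≤s⁻¹ l<1+m) l≢m))

  -- Sums over words, and their relation to the list enumeration `tuples`

  ∑ʷ : ℕ → ℕ → (List ℕ → ℕ) → ℕ
  ∑ʷ B zero    f = f []
  ∑ʷ B (suc n) f = ∑ B (λ x → ∑ʷ B n (λ w → f (x ∷ w)))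

  IsWord : ℕ → ℕ → List ℕ → Set
  IsWord B n w = All (_< B) w × length w ≡ n

  ∑ʷ-cong : ∀ B n {f g} → (∀ w → IsWord B n w → f w ≡ g w) → ∑ʷ B n f ≡ ∑ʷ B n g
  ∑ʷ-cong B zero    h = h [] ([] , refl)
  ∑ʷ-cong B (suc n) h = ∑-cong B λ x x<B → ∑ʷ-cong B n λ w (w<B , ≡n) → h (x ∷ w) (x<B ∷ w<B , cong suc ≡n)

  ∑ʷ-mono : ∀ B n {f g} → (∀ w → f w ≤ g w) → ∑ʷ B n f ≤ ∑ʷ B n g
  ∑ʷ-mono B zero    h = h []
  ∑ʷ-mono B (suc n) h = ∑-mono B λ x → ∑ʷ-mono B n λ w → h (x ∷ w)

  ∑ʷ-zero : ∀ B n → ∑ʷ B n (λ _ → 0) ≡ 0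
  ∑ʷ-zero B zero    = refl
  ∑ʷ-zero B (suc n) = trans (∑-cong B (λ _ _ → ∑ʷ-zero B n)) (∑-zero B)

  ∑ʷ-+ : ∀ B n f g → ∑ʷ B n (λ w → f w + g w) ≡ ∑ʷ B n f + ∑ʷ B n g
  ∑ʷ-+ B zero    f g = refl
  ∑ʷ-+ B (suc n) f g = trans (∑-cong B (λ _ _ → ∑ʷ-+ B n _ _)) (∑-+ B _ _)

  ∑ʷ-*ˡ : ∀ B n k f → ∑ʷ B n (λ w → k * f w) ≡ k * ∑ʷ B n f
  ∑ʷ-*ˡ B zero    k f = refl
  ∑ʷ-*ˡ B (suc n) k f = trans (∑-cong B (λ _ _ → ∑ʷ-*ˡ B n k _)) (∑-*ˡ B k _)

  ∑ʷ-∑-swap : ∀ B n m (f : List ℕ → ℕ → ℕ) → ∑ʷ B n (λ w → ∑ m (f w)) ≡ ∑ m (λ k → ∑ʷ B n (λ w → f w k))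
  ∑ʷ-∑-swap B zero    m f = refl
  ∑ʷ-∑-swap B (suc n) m f = trans (∑-cong B (λ x _ → ∑ʷ-∑-swap B n m (λ w → f (x ∷ w)))) (∑-swap B m _)

  module _ where
    open ≡-Reasoning

    sum-map-concatMap : ∀ {A C : Set} (f : C → ℕ) (g : A → List C) xs →
      sum (map f (concatMap g xs)) ≡ sum (map (λ x → sum (map f (g x))) xs)
    sum-map-concatMap f g []       = refl
    sum-map-concatMap f g (x ∷ xs) = begin
      sum (map f (g x ++ concatMap g xs))                ≡⟨ cong sum (map-++ f (g x) _) ⟩
      sum (map f (g x) ++ map f (concatMap g xs))        ≡⟨ sum-++ (map f (g x)) _ ⟩
      sum (map f (g x)) + sum (map f (concatMap g xs))   ≡⟨ cong (sum (map f (g x)) +_) (sum-map-concatMap f g xs) ⟩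
      sum (map (λ x → sum (map f (g x))) (x ∷ xs))       ∎

    sum-applyUpTo : ∀ m f → sum (applyUpTo f m) ≡ ∑ m f
    sum-applyUpTo zero    f = refl
    sum-applyUpTo (suc m) f = trans (cong (f 0 +_) (sum-applyUpTo m (f ∘ suc))) (sym (∑-head m f))

    sum-tuples : ∀ B n f → sum (map f (tuples B n)) ≡ ∑ʷ B n f
    sum-tuples B zero    f = +-identityʳ (f [])
    sum-tuples B (suc n) f = begin
      sum (map f (concatMap (λ x → map (x ∷_) (tuples B n)) (upTo B)))  ≡⟨ sum-map-concatMap f _ (upTo B) ⟩
      sum (map (λ x → sum (map f (map (x ∷_) (tuples B n)))) (upTo B))  ≡⟨ cong sum (map-upTo _ B) ⟩
      sum (applyUpTo (λ x → sum (map f (map (x ∷_) (tuples B n)))) B)   ≡⟨ sum-applyUpTo B _ ⟩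
      ∑ B (λ x → sum (map f (map (x ∷_) (tuples B n))))                 ≡⟨ ∑-cong B (λ x _ → cong sum (sym (map-∘ (tuples B n)))) ⟩
      ∑ B (λ x → sum (map (λ w → f (x ∷ w)) (tuples B n)))              ≡⟨ ∑-cong B (λ x _ → sum-tuples B n _) ⟩
      ∑ʷ B (suc n) f                                                    ∎

    length-filter : ∀ {A : Set} {P : A → Set} (P? : Decidable P) xs →
      length (filter P? xs) ≡ sum (map (λ x → ⟦ does (P? x) ⟧) xs)
    length-filter P? []       = refl
    length-filter P? (x ∷ xs) with does (P? x)
    ... | false = length-filter P? xs
    ... | true  = cong suc (length-filter P? xs)

    length-filter-filter : ∀ {A : Set} {P Q : A → Set} (P? : Decidable P) (Q? : Decidable Q) xs →
      length (filter P? (filter Q? xs)) ≡ sum (map (λ x → ⟦ does (Q? x) ⟧ * ⟦ does (P? x) ⟧) xs)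
    length-filter-filter P? Q? []       = refl
    length-filter-filter P? Q? (x ∷ xs) with does (Q? x)
    ... | false = length-filter-filter P? Q? xs
    ... | true with does (P? x)
    ...   | false = length-filter-filter P? Q? xs
    ...   | true  = cong suc (length-filter-filter P? Q? xs)

  -- Carries as quotients, and their composition

  does-≟true : ∀ β → does (β Bool.≟ true) ≡ β
  does-≟true false = refl
  does-≟true true  = refl

  -- Quotients compose where windows do not: dividing by `B` and then by `b` is dividing by `B * b`.
  -- The composition of carries rests on this.
  window≡quotient : ∀ b .{{_ : NonZero b}} j m → (⌊ j * b ≤? m ⌋ ∧ ⌊ m <? suc j * b ⌋) ≡ ⌊ m / b ≟ j ⌋
  window≡quotient b j m with m / b ≟ j
  ... | yes refl
    rewrite ⌊⌋-yes (m / b * b ≤? m) (m/n*n≤m m b)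
          | ⌊⌋-yes (m <? suc (m / b) * b) (subst (_< suc (m / b) * b) (sym (m≡m%n+[m/n]*n m b)) (+-monoˡ-< (m / b * b) (m%n<n m b)))
          = refl
  ... | no ≢j with j * b ≤? m
  ...   | no _ = refl
  ...   | yes jb≤m = ⌊⌋-no (m <? suc j * b) λ m<jb →
          ≢j (≤-antisym (s≤s⁻¹ (m<n*o⇒m/o<n {m} {suc j} {b} m<jb)) (subst (_≤ m / b) (m*n/n≡m j b) (/-monoˡ-≤ b jb≤m)))

  module _ where
    open ≡-Reasoning

    -- Each summand is split into its two digits. Since `F` sees only the total, the low digits and
    -- the high digits can be collected into two independent words.
    ∑ʷ-digits : ∀ B b n (F : ℕ → ℕ) →
      ∑ʷ (b * B) n (λ w → F (sum w)) ≡ ∑ʷ B n (λ x → ∑ʷ b n (λ z → F (sum x + sum z * B)))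
    ∑ʷ-digits B b zero    F = refl
    ∑ʷ-digits B b (suc n) F = begin
      ∑ (b * B) (λ y → ∑ʷ (b * B) n (λ w → F (y + sum w)))
        ≡⟨ ∑-cong (b * B) (λ y _ → ∑ʷ-digits B b n (λ s → F (y + s))) ⟩
      ∑ (b * B) (λ y → ∑ʷ B n (λ u → ∑ʷ b n (λ v → F (y + (sum u + sum v * B)))))
        ≡⟨ ∑-digits B b _ ⟩
      ∑ B (λ x → ∑ b (λ z → ∑ʷ B n (λ u → ∑ʷ b n (λ v → F (x + z * B + (sum u + sum v * B))))))
        ≡⟨ ∑-cong B (λ x _ → sym (∑ʷ-∑-swap B n b _)) ⟩
      ∑ B (λ x → ∑ʷ B n (λ u → ∑ b (λ z → ∑ʷ b n (λ v → F (x + z * B + (sum u + sum v * B))))))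
        ≡⟨ ∑-cong B (λ x _ → ∑ʷ-cong B n λ u _ → ∑-cong b λ z _ → ∑ʷ-cong b n λ v _ → cong F (regroup x z B (sum u) (sum v))) ⟩
      ∑ B (λ x → ∑ʷ B n (λ u → ∑ b (λ z → ∑ʷ b n (λ v → F (x + sum u + (z + sum v) * B))))) ∎
      where
      regroup : ∀ x z B s t → x + z * B + (s + t * B) ≡ x + s + (z + t) * B
      regroup = solve-∀

    -- Keeps the intermediate carry among the `suc n` states of the chain, as `∑-delta` demands.
    -- Strictness would fail for the empty word, hence the length `suc n`.
    sum<n*B : ∀ {B n w} → IsWord B (suc n) w → sum w < suc n * B
    sum<n*B {B} {n} {x ∷ []}    (x<B ∷ [] , refl) = +-monoˡ-< 0 x<B
    sum<n*B {B} {n} {x ∷ y ∷ w} (x<B ∷ w<B , refl) = +-mono-< x<B (sum<n*B (w<B , refl))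

    -- Reading the numbers in base b B, the carry out of the low digits (base B) is the carry into the high ones (base b).
    carry-composition : ∀ B b n .{{_ : NonZero B}} .{{_ : NonZero b}} .{{_ : NonZero (b * B)}} j →
      ∑ʷ (b * B) (suc n) (λ w → ⟦ ⌊ sum w / (b * B) ≟ j ⌋ ⟧) ≡
      ∑ (suc n) (λ k → ∑ʷ B (suc n) (λ x → ⟦ ⌊ sum x / B ≟ k ⌋ ⟧) * ∑ʷ b (suc n) (λ z → ⟦ ⌊ (k + sum z) / b ≟ j ⌋ ⟧))
    carry-composition B b n j = begin
      ∑ʷ (b * B) (suc n) (λ w → ⟦ ⌊ sum w / (b * B) ≟ j ⌋ ⟧)
        ≡⟨ ∑ʷ-digits B b (suc n) (λ s → ⟦ ⌊ s / (b * B) ≟ j ⌋ ⟧) ⟩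
      ∑ʷ B (suc n) (λ x → ∑ʷ b (suc n) (λ z → ⟦ ⌊ (sum x + sum z * B) / (b * B) ≟ j ⌋ ⟧))
        ≡⟨ ∑ʷ-cong B (suc n) (λ x _ → ∑ʷ-cong b (suc n) λ z _ → cong (λ q → ⟦ ⌊ q ≟ j ⌋ ⟧) (quotient (sum x) (sum z))) ⟩
      ∑ʷ B (suc n) (λ x → G (sum x / B))
        ≡⟨ ∑ʷ-cong B (suc n) (λ x wd → sym (∑-delta (suc n) (sum x / B) G (m<n*o⇒m/o<n {sum x} {suc n} {B} (sum<n*B wd)))) ⟩
      ∑ʷ B (suc n) (λ x → ∑ (suc n) (λ k → ⟦ ⌊ sum x / B ≟ k ⌋ ⟧ * G k))
        ≡⟨ ∑ʷ-∑-swap B (suc n) (suc n) (λ x k → ⟦ ⌊ sum x / B ≟ k ⌋ ⟧ * G k) ⟩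
      ∑ (suc n) (λ k → ∑ʷ B (suc n) (λ x → ⟦ ⌊ sum x / B ≟ k ⌋ ⟧ * G k))
        ≡⟨ ∑-cong (suc n) (λ k _ → trans (∑ʷ-cong B (suc n) (λ x _ → *-comm ⟦ ⌊ sum x / B ≟ k ⌋ ⟧ (G k))) (trans (∑ʷ-*ˡ B (suc n) (G k) (λ x → ⟦ ⌊ sum x / B ≟ k ⌋ ⟧)) (*-comm (G k) _))) ⟩
      ∑ (suc n) (λ k → ∑ʷ B (suc n) (λ x → ⟦ ⌊ sum x / B ≟ k ⌋ ⟧) * G k) ∎
      where
      G : ℕ → ℕ
      G k = ∑ʷ b (suc n) (λ z → ⟦ ⌊ (k + sum z) / b ≟ j ⌋ ⟧)
      quotient : ∀ s t → (s + t * B) / (b * B) ≡ (s / B + t) / b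
      quotient s t = begin
        (s + t * B) / (b * B)     ≡⟨ /-congʳ {o = B * b} {{_}} {{m*n≢0 B b}} (*-comm b B) ⟩
        ((s + t * B) / (B * b)) {{m*n≢0 B b}} ≡⟨ sym (m/n/o≡m/[n*o] (s + t * B) B b {{_}} {{_}} {{m*n≢0 B b}}) ⟩
        (s + t * B) / B / b       ≡⟨ /-congˡ {o = b} (+-distrib-/-∣ʳ s {t * B} {B} (n∣m*n t)) ⟩
        (s / B + t * B / B) / b   ≡⟨ /-congˡ {o = b} (cong (s / B +_) (m*n/n≡m t B)) ⟩
        (s / B + t) / b           ∎

    -- The letters of w are the partial sums mod B of p followed by the summands; a carry occurs exactly at a descent.
    carries≡descents : ∀ B .{{_ : NonZero B}} n p (F : ℕ → ℕ) → p < B →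
      ∑ʷ B n (λ x → F ((p + sum x) / B)) ≡ ∑ʷ B n (λ w → F (descents (p ∷ w)))
    carries≡descents B zero    p F p<B = cong F (m<n⇒m/n≡0 (subst (_< B) (sym (+-identityʳ p)) p<B))
    carries≡descents B (suc n) p F p<B = begin
      ∑ B (λ x → ∑ʷ B n (λ w → F ((p + (x + sum w)) / B)))
        ≡⟨ ∑-cong B (λ x _ → ∑ʷ-cong B n λ w _ → cong (λ s → F (s / B)) (sym (+-assoc p x (sum w)))) ⟩
      -- The next letter is `p + x` modulo `B`. For the first `B ∸ p` values of `x` it does not wrap
      -- and is at least `p`; for the last `p` values it wraps to a letter below `p`, so carry and
      -- descent occur together. Exchanging the two blocks puts the letters in increasing order.
      ∑ B (λ x → f (p + x))
        ≡⟨ cong (λ k → ∑ k (λ x → f (p + x))) (sym (m∸n+n≡m (<⇒≤ p<B))) ⟩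
      ∑ (B ∸ p + p) (λ x → f (p + x))
        ≡⟨ ∑-split (B ∸ p) p _ ⟩
      ∑ (B ∸ p) (λ x → f (p + x)) + ∑ p (λ x → f (p + (B ∸ p + x)))
        ≡⟨ cong₂ _+_ (∑-cong (B ∸ p) high) (∑-cong p low) ⟩
      ∑ (B ∸ p) (λ x → h (p + x)) + ∑ p h
        ≡⟨ +-comm _ (∑ p h) ⟩
      ∑ p h + ∑ (B ∸ p) (λ x → h (p + x))
        ≡⟨ sym (∑-split p (B ∸ p) h) ⟩
      ∑ (p + (B ∸ p)) h
        ≡⟨ cong (λ k → ∑ k h) (m+[n∸m]≡n (<⇒≤ p<B)) ⟩
      ∑ B h ∎
      where
      f h : ℕ → ℕ
      f y = ∑ʷ B n (λ w → F ((y + sum w) / B))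
      h y = ∑ʷ B n (λ w → F (descents (p ∷ y ∷ w)))
      high : ∀ x → x < B ∸ p → f (p + x) ≡ h (p + x)
      high x x<B-p = trans (carries≡descents B n (p + x) F (subst (p + x <_) (m+[n∸m]≡n (<⇒≤ p<B)) (+-monoʳ-< p x<B-p)))
        (∑ʷ-cong B n λ w _ → cong (λ β → F (⟦ β ⟧ + descents (p + x ∷ w))) (sym (⌊⌋-no (p + x <? p) (≤⇒≯ (m≤m+n p x)))))
      low : ∀ x → x < p → f (p + (B ∸ p + x)) ≡ h x
      low x x<p = begin
        ∑ʷ B n (λ w → F ((p + (B ∸ p + x) + sum w) / B))
          ≡⟨ ∑ʷ-cong B n (λ w _ → cong F (carry (sum w))) ⟩
        ∑ʷ B n (λ w → F (suc ((x + sum w) / B)))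
          -- The carry just produced is absorbed into the test function; this is why the induction
          -- runs over all `F`.
          ≡⟨ carries≡descents B n x (F ∘ suc) (<-trans x<p p<B) ⟩
        ∑ʷ B n (λ w → F (suc (descents (x ∷ w))))
          ≡⟨ ∑ʷ-cong B n (λ w _ → cong (λ β → F (⟦ β ⟧ + descents (x ∷ w))) (sym (⌊⌋-yes (x <? p) x<p))) ⟩
        h x ∎
        where
        carry : ∀ s → (p + (B ∸ p + x) + s) / B ≡ suc ((x + s) / B)
        carry s = begin
          (p + (B ∸ p + x) + s) / B ≡⟨ /-congˡ (trans (cong (_+ s) (trans (sym (+-assoc p (B ∸ p) x)) (cong (_+ x) (m+[n∸m]≡n (<⇒≤ p<B))))) (+-assoc B x s)) ⟩
          (B + (x + s)) / B         ≡⟨ m/n≡1+[m∸n]/n (m≤m+n B (x + s)) ⟩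
          suc ((B + (x + s) ∸ B) / B) ≡⟨ cong suc (/-congˡ (m+n∸m≡n B (x + s))) ⟩
          suc ((x + s) / B)         ∎

  -- The chain starts at carry `0`, so the partial sums start at the letter `0`, and no letter lies
  -- below it.
  descents-0∷ : ∀ w → descents (0 ∷ w) ≡ descents w
  descents-0∷ []      = refl
  descents-0∷ (y ∷ w) = refl

  -- Words without repetitions, and insertion of a largest letter

  ∑ᵈ : ℕ → ℕ → (List ℕ → ℕ) → ℕ
  ∑ᵈ B n f = ∑ʷ B n (λ w → ⟦ distinct w ⟧ * f w)

  ∑-insertions : ℕ → (List ℕ → ℕ) → List ℕ → ℕ
  ∑-insertions x f []      = f (x ∷ [])
  ∑-insertions x f (y ∷ w) = f (x ∷ y ∷ w) + ∑-insertions x (λ v → f (y ∷ v)) w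

  module _ where
    open ≡-Reasoning

    ∑ʷ-avoid-top : ∀ B n f → ∑ʷ (suc B) n (λ w → ⟦ notElem B w ⟧ * f w) ≡ ∑ʷ B n f
    ∑ʷ-avoid-top B zero    f = +-identityʳ (f [])
    ∑ʷ-avoid-top B (suc n) f = begin
      ∑ B (λ x → ∑ʷ (suc B) n (λ w → ⟦ not ⌊ B ≟ x ⌋ ∧ notElem B w ⟧ * f (x ∷ w))) +
        ∑ʷ (suc B) n (λ w → ⟦ not ⌊ B ≟ B ⌋ ∧ notElem B w ⟧ * f (B ∷ w))
          ≡⟨ cong₂ _+_ (∑-cong B below) top ⟩
      ∑ B (λ x → ∑ʷ B n (λ w → f (x ∷ w))) + 0  ≡⟨ +-identityʳ _ ⟩
      ∑ʷ B (suc n) f ∎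
      where
      below : ∀ x → x < B → ∑ʷ (suc B) n (λ w → ⟦ not ⌊ B ≟ x ⌋ ∧ notElem B w ⟧ * f (x ∷ w)) ≡ ∑ʷ B n (λ w → f (x ∷ w))
      below x x<B rewrite ⌊⌋-no (B ≟ x) (>⇒≢ x<B) = ∑ʷ-avoid-top B n (λ w → f (x ∷ w))
      top : ∑ʷ (suc B) n (λ w → ⟦ not ⌊ B ≟ B ⌋ ∧ notElem B w ⟧ * f (B ∷ w)) ≡ 0
      top rewrite ⌊⌋-yes (B ≟ B) refl = ∑ʷ-zero (suc B) n

    -- Inserting `B` cannot create or destroy an occurrence of another letter `y`, so the condition
    -- that the first letter does not recur commutes with inserting `B` behind it.
    ∑-insertions-notElem : ∀ B y f w → y ≢ B →
      ∑-insertions B (λ v → ⟦ notElem y v ⟧ * f v) w ≡ ⟦ notElem y w ⟧ * ∑-insertions B f w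
    ∑-insertions-notElem B y f [] y≢B rewrite ⌊⌋-no (y ≟ B) y≢B = refl
    ∑-insertions-notElem B y f (z ∷ w) y≢B rewrite ⌊⌋-no (y ≟ B) y≢B with y ≟ z
    ... | yes _ = ∑-insertions-0 w
      where
      ∑-insertions-0 : ∀ w → ∑-insertions B (λ _ → 0) w ≡ 0
      ∑-insertions-0 []      = refl
      ∑-insertions-0 (_ ∷ w) = ∑-insertions-0 w
    ... | no _ = trans (cong (⟦ notElem y w ⟧ * f (B ∷ z ∷ w) +_) (∑-insertions-notElem B y (λ v → f (z ∷ v)) w y≢B))
                       (sym (*-distribˡ-+ ⟦ notElem y w ⟧ _ _))

    ∑ᵈ-cons : ∀ B n f → ∑ᵈ B (suc n) f ≡ ∑ B (λ x → ∑ᵈ B n (λ w → ⟦ notElem x w ⟧ * f (x ∷ w)))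
    ∑ᵈ-cons B n f = ∑-cong B λ x _ → ∑ʷ-cong B n λ w _ →
      trans (cong (_* f (x ∷ w)) (trans (⟦∧⟧ (notElem x w) (distinct w)) (*-comm ⟦ notElem x w ⟧ _))) (*-assoc ⟦ distinct w ⟧ _ _)

    -- A word without repetitions over {0,…,B} either avoids B or arises by inserting B into a word over {0,…,B-1}.
    ∑ᵈ-suc : ∀ B n f → ∑ᵈ (suc B) (suc n) f ≡ ∑ᵈ B (suc n) f + ∑ᵈ B n (∑-insertions B f)
    ∑ᵈ-suc B zero    f = refl
    ∑ᵈ-suc B (suc n) f = begin
      ∑ᵈ (suc B) (suc (suc n)) f
        ≡⟨ ∑ᵈ-cons (suc B) (suc n) f ⟩
      ∑ B (λ x → ∑ᵈ (suc B) (suc n) (f′ x)) + ∑ᵈ (suc B) (suc n) (f′ B)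
        -- A first letter below `B` leaves the induction hypothesis for the rest of the word; a
        -- first letter `B` forces the rest to avoid `B`.
        ≡⟨ cong₂ _+_ (∑-cong B λ x x<B → trans (∑ᵈ-suc B n (f′ x)) (cong (∑ᵈ B (suc n) (f′ x) +_) (rest x x<B))) first ⟩
      ∑ B (λ x → ∑ᵈ B (suc n) (f′ x) + ∑ᵈ B n (λ w → ⟦ notElem x w ⟧ * ∑-insertions B (λ v → f (x ∷ v)) w)) + ∑ᵈ B (suc n) (λ w → f (B ∷ w))
        ≡⟨ cong (_+ ∑ᵈ B (suc n) (λ w → f (B ∷ w))) (∑-+ B _ _) ⟩
      ∑ B (λ x → ∑ᵈ B (suc n) (f′ x)) + ∑ B (λ x → ∑ᵈ B n (λ w → ⟦ notElem x w ⟧ * ∑-insertions B (λ v → f (x ∷ v)) w)) + ∑ᵈ B (suc n) (λ w → f (B ∷ w))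
        ≡⟨ cong₂ (λ s t → s + t + ∑ᵈ B (suc n) (λ w → f (B ∷ w))) (sym (∑ᵈ-cons B (suc n) f)) (sym (∑ᵈ-cons B n tail)) ⟩
      ∑ᵈ B (suc (suc n)) f + ∑ᵈ B (suc n) tail + ∑ᵈ B (suc n) (λ w → f (B ∷ w))
        ≡⟨ +-assoc (∑ᵈ B (suc (suc n)) f) _ _ ⟩
      ∑ᵈ B (suc (suc n)) f + (∑ᵈ B (suc n) tail + ∑ᵈ B (suc n) (λ w → f (B ∷ w)))
        ≡⟨ cong (∑ᵈ B (suc (suc n)) f +_) (sym (∑ʷ-+ B (suc n) (λ w → ⟦ distinct w ⟧ * tail w) (λ w → ⟦ distinct w ⟧ * f (B ∷ w)))) ⟩
      ∑ᵈ B (suc (suc n)) f + ∑ʷ B (suc n) (λ w → ⟦ distinct w ⟧ * tail w + ⟦ distinct w ⟧ * f (B ∷ w))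
        ≡⟨ cong (∑ᵈ B (suc (suc n)) f +_) (∑ʷ-cong B (suc n) λ w (_ , ≡n) → trans (sym (*-distribˡ-+ ⟦ distinct w ⟧ (tail w) (f (B ∷ w)))) (cong (⟦ distinct w ⟧ *_) (join w ≡n))) ⟩
      ∑ᵈ B (suc (suc n)) f + ∑ᵈ B (suc n) (∑-insertions B f) ∎
      where
      f′ : ℕ → List ℕ → ℕ
      f′ x w = ⟦ notElem x w ⟧ * f (x ∷ w)
      -- The insertions of `B` behind the first letter. Together with the insertion in front they
      -- are all insertions into a nonempty word, which is what `join` records.
      tail : List ℕ → ℕ
      tail []      = 0
      tail (x ∷ w) = ∑-insertions B (λ v → f (x ∷ v)) w
      rest : ∀ x → x < B → ∑ᵈ B n (∑-insertions B (f′ x)) ≡ ∑ᵈ B n (λ w → ⟦ notElem x w ⟧ * ∑-insertions B (λ v → f (x ∷ v)) w)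
      rest x x<B = ∑ʷ-cong B n λ w _ → cong (⟦ distinct w ⟧ *_) (∑-insertions-notElem B x (λ v → f (x ∷ v)) w (<⇒≢ x<B))
      first : ∑ᵈ (suc B) (suc n) (f′ B) ≡ ∑ᵈ B (suc n) (λ w → f (B ∷ w))
      first = trans (∑ʷ-cong (suc B) (suc n) λ w _ → swap ⟦ distinct w ⟧ ⟦ notElem B w ⟧ (f (B ∷ w)))
                    (∑ʷ-avoid-top B (suc n) (λ w → ⟦ distinct w ⟧ * f (B ∷ w)))
        where
        swap : ∀ a b c → a * (b * c) ≡ b * (a * c)
        swap = solve-∀
      join : ∀ w → length w ≡ suc n → tail w + f (B ∷ w) ≡ ∑-insertions B f w
      join (x ∷ w) _ = +-comm (tail (x ∷ w)) (f (B ∷ x ∷ w))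

  -- Descents under insertion, and the Eulerian numbers

  descents≤length : ∀ x w → descents (x ∷ w) ≤ length w
  descents≤length x []      = z≤n
  descents≤length x (y ∷ w) = +-mono-≤ (⟦⟧≤1 ⌊ y <? x ⌋) (descents≤length y w)

  -- Of the n + 1 slots of a word with d descents, a new largest letter creates no descent at the end and
  -- inside the d descents, and one new descent in the other n - d slots.
  insertStep : ℕ → (ℕ → ℕ) → ℕ → ℕ
  insertStep n g d = suc d * g d + (n ∸ d) * g (suc d)

  module _ where
    open ≡-Reasoning

    -- The front slot is left out to let the induction run. The slot between `y` and `z` always
    -- brings the descent from `B` to `z`; it replaces a descent from `y` to `z` or is a new one,
    -- the two cases of `step`. The front slot is restored in `∑-insertions-descents`.
    ∑-insertions-after : ∀ B y w g → All (_< B) (y ∷ w) →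
      ∑-insertions B (λ v → g (descents (y ∷ v))) w ≡ insertStep (length w) g (descents (y ∷ w))
    ∑-insertions-after B y [] g (y<B ∷ [])
      rewrite ⌊⌋-no (B <? y) (<-asym y<B) = sym (trans (+-identityʳ _) (+-identityʳ _))
    ∑-insertions-after B y (z ∷ w) g (y<B ∷ z<B ∷ w<B) = begin
      g (⟦ ⌊ B <? y ⌋ ⟧ + (⟦ ⌊ z <? B ⌋ ⟧ + d′)) + ∑-insertions B (λ v → g (⟦ ⌊ z <? y ⌋ ⟧ + descents (z ∷ v))) w
        ≡⟨ cong₂ (λ α β → g (⟦ α ⟧ + (⟦ β ⟧ + d′)) + ∑-insertions B (λ v → g (⟦ ⌊ z <? y ⌋ ⟧ + descents (z ∷ v))) w)
                 (⌊⌋-no (B <? y) (<-asym y<B)) (⌊⌋-yes (z <? B) z<B) ⟩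
      g (suc d′) + ∑-insertions B (λ v → g (⟦ ⌊ z <? y ⌋ ⟧ + descents (z ∷ v))) w
        ≡⟨ cong (g (suc d′) +_) (∑-insertions-after B z w (λ k → g (⟦ ⌊ z <? y ⌋ ⟧ + k)) (z<B ∷ w<B)) ⟩
      g (suc d′) + insertStep (length w) (λ k → g (⟦ ⌊ z <? y ⌋ ⟧ + k)) d′
        ≡⟨ step ⌊ z <? y ⌋ ⟩
      insertStep (suc (length w)) g (⟦ ⌊ z <? y ⌋ ⟧ + d′) ∎
      where
      d′ : ℕ
      d′ = descents (z ∷ w)
      step : ∀ β → g (suc d′) + insertStep (length w) (λ k → g (⟦ β ⟧ + k)) d′ ≡ insertStep (suc (length w)) g (⟦ β ⟧ + d′)
      step true  = sym (+-assoc (g (suc d′)) _ _)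
      step false = begin
        g (suc d′) + (suc d′ * g d′ + (length w ∸ d′) * g (suc d′)) ≡⟨ regroup (g (suc d′)) (suc d′ * g d′) (length w ∸ d′) ⟩
        suc d′ * g d′ + suc (length w ∸ d′) * g (suc d′)            ≡⟨ cong (λ k → suc d′ * g d′ + k * g (suc d′)) (sym (+-∸-assoc 1 (descents≤length z w))) ⟩
        suc d′ * g d′ + (suc (length w) ∸ d′) * g (suc d′)          ∎
        where
        regroup : ∀ a b c → a + (b + c * a) ≡ b + (1 + c) * a
        regroup = solve-∀

    ∑-insertions-descents : ∀ B w g → All (_< B) w →
      ∑-insertions B (λ v → g (descents v)) w ≡ insertStep (length w) g (descents w)
    ∑-insertions-descents B [] g _ = sym (trans (+-identityʳ _) (+-identityʳ _))
    ∑-insertions-descents B (y ∷ w) g (y<B ∷ w<B) = begin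
      g (⟦ ⌊ y <? B ⌋ ⟧ + d) + ∑-insertions B (λ v → g (descents (y ∷ v))) w
        ≡⟨ cong₂ _+_ (cong (λ β → g (⟦ β ⟧ + d)) (⌊⌋-yes (y <? B) y<B)) (∑-insertions-after B y w g (y<B ∷ w<B)) ⟩
      g (suc d) + (suc d * g d + (length w ∸ d) * g (suc d)) ≡⟨ regroup (g (suc d)) (suc d * g d) (length w ∸ d) ⟩
      suc d * g d + suc (length w ∸ d) * g (suc d)           ≡⟨ cong (λ k → suc d * g d + k * g (suc d)) (sym (+-∸-assoc 1 (descents≤length y w))) ⟩
      suc d * g d + (suc (length w) ∸ d) * g (suc d)         ∎
      where
      d : ℕ
      d = descents (y ∷ w)
      regroup : ∀ a b c → a + (b + c * a) ≡ b + (1 + c) * a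
      regroup = solve-∀

  -- eulerianSum n g = Σⱼ A(n,j) g(j), by the recurrence of the Eulerian numbers.
  eulerianSum : ℕ → (ℕ → ℕ) → ℕ
  eulerianSum zero    g = g 0
  eulerianSum (suc n) g = eulerianSum n (insertStep n g)

  module _ where
    open ≡-Reasoning

    -- Splitting by the occurrence of the largest letter is Pascal's rule for `B C n`, while the
    -- inserted letter acts on `g` through `insertStep`, the recurrence that defines `eulerianSum`.
    -- Both sides thus satisfy the same recursion in `B` and `n`.
    ∑ᵈ-descents : ∀ B n g → ∑ᵈ B n (λ w → g (descents w)) ≡ (B C n) * eulerianSum n g
    ∑ᵈ-descents B       zero    g = refl
    ∑ᵈ-descents zero    (suc n) g = refl
    ∑ᵈ-descents (suc B) (suc n) g = begin
      ∑ᵈ (suc B) (suc n) (λ w → g (descents w))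
        ≡⟨ ∑ᵈ-suc B n _ ⟩
      ∑ᵈ B (suc n) (λ w → g (descents w)) + ∑ᵈ B n (∑-insertions B (λ w → g (descents w)))
        ≡⟨ cong₂ _+_ (∑ᵈ-descents B (suc n) g)
             (trans (∑ʷ-cong B n λ { w (w<B , refl) → cong (⟦ distinct w ⟧ *_) (∑-insertions-descents B w g w<B) })
                    (∑ᵈ-descents B n (insertStep n g))) ⟩
      (B C suc n) * E + (B C n) * E  ≡⟨ sym (*-distribʳ-+ E (B C suc n) (B C n)) ⟩
      (B C suc n + B C n) * E        ≡⟨ cong (_* E) (trans (+-comm (B C suc n) (B C n)) (nCk+nC[k+1]≡[n+1]C[k+1] B n)) ⟩
      (suc B C suc n) * E            ∎
      where
      E : ℕ
      E = eulerianSum (suc n) g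

    -- The alphabet of size `n` in `∑ᵈ-descents`: distinct words of length `n` are then the
    -- permutations, and `n C n` is 1.
    eulerian≡eulerianSum : ∀ n j → eulerian n j ≡ eulerianSum n (λ d → ⟦ ⌊ d ≟ j ⌋ ⟧)
    eulerian≡eulerianSum n j = begin
      eulerian n j
        ≡⟨ length-filter-filter (λ σ → descents σ ≟ j) (λ w → distinct w Bool.≟ true) (tuples n n) ⟩
      sum (map (λ w → ⟦ does (distinct w Bool.≟ true) ⟧ * ⟦ does (descents w ≟ j) ⟧) (tuples n n))
        ≡⟨ sum-tuples n n _ ⟩
      ∑ʷ n n (λ w → ⟦ does (distinct w Bool.≟ true) ⟧ * ⟦ does (descents w ≟ j) ⟧)
        ≡⟨ ∑ʷ-cong n n (λ w _ → cong₂ (λ α β → ⟦ α ⟧ * ⟦ β ⟧) (does-≟true (distinct w)) (sym (isYes≗does (descents w ≟ j)))) ⟩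
      ∑ᵈ n n (λ w → ⟦ ⌊ descents w ≟ j ⌋ ⟧)
        ≡⟨ ∑ᵈ-descents n n _ ⟩
      (n C n) * eulerianSum n (λ d → ⟦ ⌊ d ≟ j ⌋ ⟧)
        ≡⟨ cong (_* eulerianSum n _) (nCn≡1 n) ⟩
      1 * eulerianSum n (λ d → ⟦ ⌊ d ≟ j ⌋ ⟧)
        ≡⟨ *-identityˡ _ ⟩
      eulerianSum n (λ d → ⟦ ⌊ d ≟ j ⌋ ⟧) ∎

  insertStep-mono : ∀ n {f g} → (∀ d → f d ≤ g d) → ∀ d → insertStep n f d ≤ insertStep n g d
  insertStep-mono n h d = +-mono-≤ (*-monoʳ-≤ (suc d) (h d)) (*-monoʳ-≤ (n ∸ d) (h (suc d)))

  eulerianSum-mono : ∀ n {f g} → (∀ d → f d ≤ g d) → eulerianSum n f ≤ eulerianSum n g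
  eulerianSum-mono zero    h = h 0
  eulerianSum-mono (suc n) h = eulerianSum-mono n (insertStep-mono n h)

  -- Makes division by `eulerian n j` genuine, since `frac _ 0` is `0`. Below the top value of `j`,
  -- the new largest letter can be inserted without a new descent; at the top value, a word with all
  -- descents still has one slot that adds a descent.
  eulerianSum-positive : ∀ n j → j ≤ n → 0 < eulerianSum (suc n) (λ d → ⟦ ⌊ d ≟ j ⌋ ⟧)
  eulerianSum-positive zero    zero _   = s≤s z≤n
  eulerianSum-positive (suc n) j    j≤1+n with j ≟ suc n
  ... | no j≢1+n = ≤-trans (eulerianSum-positive n j (s≤s⁻¹ (≤∧≢⇒< j≤1+n j≢1+n)))
    (eulerianSum-mono (suc n) λ d → ≤-trans (m≤m+n _ (d * ⟦ ⌊ d ≟ j ⌋ ⟧)) (m≤m+n _ _))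
  ... | yes refl = ≤-trans (eulerianSum-positive n n ≤-refl) (eulerianSum-mono (suc n) le)
    where
    le : ∀ d → ⟦ ⌊ d ≟ n ⌋ ⟧ ≤ insertStep (suc n) (λ d → ⟦ ⌊ d ≟ suc n ⌋ ⟧) d
    le d with d ≟ n
    ... | no _ = z≤n
    ... | yes refl rewrite ⌊⌋-yes (suc d ≟ suc d) refl | m+n∸n≡m 1 d = m≤n+m 1 _

  eulerian-positive : ∀ n j → j < n → 0 < eulerian n j
  eulerian-positive (suc n) j j<n = subst (0 <_) (sym (eulerian≡eulerianSum (suc n) j)) (eulerianSum-positive n j (s≤s⁻¹ j<n))

  -- With the maximal number of descents every step goes down. The bound of all letters by the first
  -- one is carried along because distinctness of the longer word needs it: the new first letter
  -- exceeds `y`, hence everything after it.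
  maximal-descents : ∀ x w → descents (x ∷ w) ≡ length w → distinct (x ∷ w) ≡ true × All (_≤ x) w
  maximal-descents x []      _ = refl , []
  maximal-descents x (y ∷ w) eq with y <? x
  ... | no  _ = contradiction (subst (_≤ length w) eq (descents≤length y w)) 1+n≰n
  ... | yes y<x with maximal-descents y w (suc-injective eq)
  ...   | dist , w≤y = cong₂ _∧_ (absent (≤-refl ∷ w≤y)) dist , <⇒≤ y<x ∷ All.map (λ z≤y → ≤-trans z≤y (<⇒≤ y<x)) w≤y
    where
    absent : ∀ {v} → All (_≤ y) v → notElem x v ≡ true
    absent []                = refl
    absent {z ∷ v} (z≤y ∷ h) rewrite ⌊⌋-no (x ≟ z) (>⇒≢ (≤-<-trans z≤y y<x)) = absent h

  -- Words with `j` descents compared with distinct words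

  carryCount : ℕ → ℕ → ℕ → ℕ
  carryCount B n j = ∑ʷ B n (λ w → ⟦ ⌊ descents w ≟ j ⌋ ⟧)

  carryCount-≥ : ∀ B n j → (B C n) * eulerian n j ≤ carryCount B n j
  carryCount-≥ B n j = subst (_≤ carryCount B n j)
    (trans (∑ᵈ-descents B n _) (cong ((B C n) *_) (sym (eulerian≡eulerianSum n j))))
    (∑ʷ-mono B n λ w → ≤-trans (*-monoˡ-≤ _ (⟦⟧≤1 (distinct w))) (≤-reflexive (*-identityˡ _)))

  carryCount-top : ∀ B n → carryCount B (suc n) n ≡ (B C suc n) * eulerian (suc n) n
  carryCount-top B n = trans (sym (∑ʷ-cong B (suc n) allDistinct))
    (trans (∑ᵈ-descents B (suc n) _) (cong ((B C suc n) *_) (sym (eulerian≡eulerianSum (suc n) n))))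
    where
    allDistinct : ∀ w → IsWord B (suc n) w → ⟦ distinct w ⟧ * ⟦ ⌊ descents w ≟ n ⌋ ⟧ ≡ ⟦ ⌊ descents w ≟ n ⌋ ⟧
    allDistinct (x ∷ w) (_ , len) with descents (x ∷ w) ≟ n
    ... | no _   = *-zeroʳ ⟦ distinct (x ∷ w) ⟧
    ... | yes eq = cong (λ β → ⟦ β ⟧ * 1) (proj₁ (maximal-descents x w (trans eq (sym (suc-injective len)))))

  -- (B C n) n! is the falling factorial of B, so consecutive values have ratio B - n.
  C-absorb : ∀ B n → suc n * (B C suc n) + n * (B C n) ≡ B * (B C n)
  C-absorb zero    zero    = refl
  C-absorb zero    (suc n) = cong₂ _+_ (*-zeroʳ (suc (suc n))) (*-zeroʳ (suc n))
  C-absorb (suc B) zero    = begin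
    1 * (suc B C 1) + 0            ≡⟨ +-identityʳ _ ⟩
    1 * (suc B C 1)                ≡⟨ *-identityˡ _ ⟩
    suc B C 1                      ≡⟨ sym (nCk+nC[k+1]≡[n+1]C[k+1] B 0) ⟩
    1 + B C 1                      ≡⟨ cong suc (trans (sym (trans (+-identityʳ _) (*-identityˡ _))) (C-absorb B 0)) ⟩
    1 + B * 1                      ∎
    where open ≡-Reasoning
  C-absorb (suc B) (suc n) = begin
    suc (suc n) * (suc B C suc (suc n)) + suc n * (suc B C suc n)
      ≡⟨ cong₂ (λ s t → suc (suc n) * s + suc n * t) (sym (nCk+nC[k+1]≡[n+1]C[k+1] B (suc n))) (sym (nCk+nC[k+1]≡[n+1]C[k+1] B n)) ⟩
    suc (suc n) * (c₁ + c₂) + suc n * (c₀ + c₁)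
      ≡⟨ regroup n c₀ c₁ c₂ ⟩
    (suc n * c₁ + n * c₀) + (suc (suc n) * c₂ + suc n * c₁) + (c₀ + c₁)
      ≡⟨ cong₂ (λ s t → s + t + (c₀ + c₁)) (C-absorb B n) (C-absorb B (suc n)) ⟩
    B * c₀ + B * c₁ + (c₀ + c₁)
      ≡⟨ collect B c₀ c₁ ⟩
    suc B * (c₀ + c₁)
      ≡⟨ cong (suc B *_) (nCk+nC[k+1]≡[n+1]C[k+1] B n) ⟩
    suc B * (suc B C suc n) ∎
    where
    open ≡-Reasoning
    c₀ c₁ c₂ : ℕ
    c₀ = B C n
    c₁ = B C suc n
    c₂ = B C suc (suc n)
    regroup : ∀ n x y z → (2 + n) * (y + z) + (1 + n) * (x + y) ≡ ((1 + n) * y + n * x) + ((2 + n) * z + (1 + n) * y) + (x + y)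
    regroup = solve-∀
    collect : ∀ B x y → B * x + B * y + (x + y) ≡ (1 + B) * (x + y)
    collect = solve-∀

-- Rational arithmetic and the exponential approximation

module ExponentialLimit where

  import Data.Nat as ℕ
  import Data.Nat.Properties as ℕ
  open import Data.Nat using (ℕ; zero; suc; _!)
  import Data.Integer as ℤ
  import Data.Integer.Properties as ℤ
  open import Data.Rational hiding (_≃_; *≡*; *≤*)
  open import Data.Rational.Properties
  open import Data.Rational.Unnormalised using (mkℚᵘ; *≡*; *≤*; _≃_)
  import Data.Rational.Unnormalised as ℚᵘ
  import Data.Rational.Unnormalised.Properties as ℚᵘ
  open import Data.List using (foldr; applyUpTo)
  open import Data.Maybe using (Maybe; just; nothing)
  open import Data.Product using (Σ; _×_; _,_; proj₁; proj₂)
  open import Data.Sum using (inj₁; inj₂; [_,_]′)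
  open import Function using (_∘_; id)
  open import Level using (0ℓ)
  open import Relation.Nullary using (yes; no)
  open import Relation.Binary.PropositionalEquality
  open import Tactic.RingSolver using (solve-∀)
  open import Tactic.RingSolver.Core.AlmostCommutativeRing using (AlmostCommutativeRing; fromCommutativeRing)

  ℚ-ring : AlmostCommutativeRing 0ℓ 0ℓ
  ℚ-ring = fromCommutativeRing +-*-commutativeRing isZero
    where
    isZero : ∀ x → Maybe (0ℚ ≡ x)
    isZero x with 0ℚ ≟ x
    ... | yes eq = just eq
    ... | no  _  = nothing

  toℚᵘ-ℕtoℚ : ∀ k → toℚᵘ (ℕtoℚ k) ≃ mkℚᵘ (ℤ.+ k) 0
  toℚᵘ-ℕtoℚ k = toℚᵘ-fromℚᵘ (mkℚᵘ (ℤ.+ k) 0)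

  module _ where
    open ℚᵘ.≃-Reasoning

    ℕtoℚ-+ : ∀ m n → ℕtoℚ (m ℕ.+ n) ≡ ℕtoℚ m + ℕtoℚ n
    ℕtoℚ-+ m n = toℚᵘ-injective (begin
      toℚᵘ (ℕtoℚ (m ℕ.+ n))                     ≈⟨ toℚᵘ-ℕtoℚ (m ℕ.+ n) ⟩
      mkℚᵘ (ℤ.+ (m ℕ.+ n)) 0                    ≈⟨ *≡* (cong (ℤ._* ℤ.1ℤ) (sym (cong₂ ℤ._+_ (ℤ.*-identityʳ (ℤ.+ m)) (ℤ.*-identityʳ (ℤ.+ n))))) ⟩
      mkℚᵘ (ℤ.+ m) 0 ℚᵘ.+ mkℚᵘ (ℤ.+ n) 0        ≈⟨ ℚᵘ.+-cong (ℚᵘ.≃-sym (toℚᵘ-ℕtoℚ m)) (ℚᵘ.≃-sym (toℚᵘ-ℕtoℚ n)) ⟩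
      toℚᵘ (ℕtoℚ m) ℚᵘ.+ toℚᵘ (ℕtoℚ n)          ≈⟨ ℚᵘ.≃-sym (toℚᵘ-homo-+ (ℕtoℚ m) (ℕtoℚ n)) ⟩
      toℚᵘ (ℕtoℚ m + ℕtoℚ n)                    ∎)

    ℕtoℚ-* : ∀ m n → ℕtoℚ (m ℕ.* n) ≡ ℕtoℚ m * ℕtoℚ n
    ℕtoℚ-* m n = toℚᵘ-injective (begin
      toℚᵘ (ℕtoℚ (m ℕ.* n))                     ≈⟨ toℚᵘ-ℕtoℚ (m ℕ.* n) ⟩
      mkℚᵘ (ℤ.+ (m ℕ.* n)) 0                    ≈⟨ *≡* (cong (ℤ._* ℤ.1ℤ) (ℤ.pos-* m n)) ⟩
      mkℚᵘ (ℤ.+ m) 0 ℚᵘ.* mkℚᵘ (ℤ.+ n) 0        ≈⟨ ℚᵘ.*-cong (ℚᵘ.≃-sym (toℚᵘ-ℕtoℚ m)) (ℚᵘ.≃-sym (toℚᵘ-ℕtoℚ n)) ⟩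
      toℚᵘ (ℕtoℚ m) ℚᵘ.* toℚᵘ (ℕtoℚ n)          ≈⟨ ℚᵘ.≃-sym (toℚᵘ-homo-* (ℕtoℚ m) (ℕtoℚ n)) ⟩
      toℚᵘ (ℕtoℚ m * ℕtoℚ n)                    ∎)

    /-*-cancel : ∀ p d → ((ℤ.+ p) / suc d) * ℕtoℚ (suc d) ≡ ℕtoℚ p
    /-*-cancel p d = toℚᵘ-injective (begin
      toℚᵘ (((ℤ.+ p) / suc d) * ℕtoℚ (suc d))            ≈⟨ toℚᵘ-homo-* ((ℤ.+ p) / suc d) (ℕtoℚ (suc d)) ⟩
      toℚᵘ ((ℤ.+ p) / suc d) ℚᵘ.* toℚᵘ (ℕtoℚ (suc d))    ≈⟨ ℚᵘ.*-cong (toℚᵘ-fromℚᵘ (mkℚᵘ (ℤ.+ p) d)) (toℚᵘ-ℕtoℚ (suc d)) ⟩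
      mkℚᵘ (ℤ.+ p) d ℚᵘ.* mkℚᵘ (ℤ.+ suc d) 0             ≈⟨ *≡* (trans (ℤ.*-identityʳ _) (cong (λ k → ℤ.+ p ℤ.* (ℤ.+ k)) (sym (ℕ.*-identityʳ (suc d))))) ⟩
      mkℚᵘ (ℤ.+ p) 0                                     ≈⟨ ℚᵘ.≃-sym (toℚᵘ-ℕtoℚ p) ⟩
      toℚᵘ (ℕtoℚ p)                                      ∎)

  frac-*-cancel : ∀ p d .{{_ : ℕ.NonZero d}} → frac p d * ℕtoℚ d ≡ ℕtoℚ p
  frac-*-cancel p (suc d) = /-*-cancel p d

  ℕtoℚ-mono : ∀ {m n} → m ℕ.≤ n → ℕtoℚ m ≤ ℕtoℚ n
  ℕtoℚ-mono {m} {n} m≤n = toℚᵘ-cancel-≤ (ℚᵘ.≤-respˡ-≃ (ℚᵘ.≃-sym (toℚᵘ-ℕtoℚ m)) (ℚᵘ.≤-respʳ-≃ (ℚᵘ.≃-sym (toℚᵘ-ℕtoℚ n))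
    (*≤* (ℤ.*-monoʳ-≤-nonNeg ℤ.1ℤ (ℤ.+≤+ m≤n)))))

  ℕtoℚ-nonNeg : ∀ n → 0ℚ ≤ ℕtoℚ n
  ℕtoℚ-nonNeg n = ℕtoℚ-mono {0} {n} ℕ.z≤n

  ℕtoℚ-pos : ∀ n .{{_ : ℕ.NonZero n}} → 0ℚ < ℕtoℚ n
  ℕtoℚ-pos n = <-≤-trans (positive⁻¹ 1ℚ) (ℕtoℚ-mono (ℕ.>-nonZero⁻¹ n))

  ℕtoℚ-suc : ∀ n → ℕtoℚ (suc n) ≡ 1ℚ + ℕtoℚ n
  ℕtoℚ-suc n = ℕtoℚ-+ 1 n

  archimedean : ∀ q → Σ ℕ λ N → q ≤ ℕtoℚ N
  archimedean q@(mkℚ (ℤ.+ p) d _) = p , toℚᵘ-cancel-≤ (ℚᵘ.≤-respʳ-≃ (ℚᵘ.≃-sym (toℚᵘ-ℕtoℚ p))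
    (*≤* (ℤ.*-monoˡ-≤-nonNeg (ℤ.+ p) (ℤ.+≤+ (ℕ.s≤s (ℕ.z≤n {d}))))))
  archimedean q@(mkℚ ℤ.-[1+ p ] d _) = 0 , <⇒≤ (negative⁻¹ q)

  *-monoʳ : ∀ {r p q} → 0ℚ ≤ r → p ≤ q → p * r ≤ q * r
  *-monoʳ {r} 0≤r = *-monoʳ-≤-nonNeg r {{nonNegative 0≤r}}

  *-monoˡ : ∀ {r p q} → 0ℚ ≤ r → p ≤ q → r * p ≤ r * q
  *-monoˡ {r} 0≤r = *-monoˡ-≤-nonNeg r {{nonNegative 0≤r}}

  *-nonNeg : ∀ {p q} → 0ℚ ≤ p → 0ℚ ≤ q → 0ℚ ≤ p * q
  *-nonNeg {p} {q} 0≤p 0≤q = subst (_≤ p * q) (*-zeroʳ p) (*-monoˡ 0≤p 0≤q)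

  +-nonNeg : ∀ {p q} → 0ℚ ≤ p → 0ℚ ≤ q → 0ℚ ≤ p + q
  +-nonNeg 0≤p 0≤q = +-mono-≤ 0≤p 0≤q

  *-cancelˡ : ∀ {r p q} → 0ℚ < r → r * p ≤ r * q → p ≤ q
  *-cancelˡ {r} 0<r = *-cancelˡ-≤-pos r {{positive 0<r}}

  *-cancelˡ-≡ : ∀ {r p q} → 0ℚ < r → r * p ≡ r * q → p ≡ q
  *-cancelˡ-≡ 0<r eq = ≤-antisym (*-cancelˡ 0<r (≤-reflexive eq)) (*-cancelˡ 0<r (≤-reflexive (sym eq)))

  0≤q-p : ∀ {p q} → p ≤ q → 0ℚ ≤ q - p
  0≤q-p {p} {q} p≤q = subst (_≤ q - p) (+-inverseʳ p) (+-monoˡ-≤ (- p) p≤q)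

  p-q≤p : ∀ {p q} → 0ℚ ≤ q → p - q ≤ p
  p-q≤p {p} {q} 0≤q = subst (p - q ≤_) (+-identityʳ p) (+-monoʳ-≤ p (neg-antimono-≤ 0≤q))

  double-cancel : ∀ {p q} → p + p ≤ q + q → p ≤ q
  double-cancel {p} {q} h = *-cancelˡ {1ℚ + 1ℚ} (positive⁻¹ _) (subst₂ _≤_ (dbl p) (dbl q) h)
    where
    dbl : ∀ p → p + p ≡ (1ℚ + 1ℚ) * p
    dbl = solve-∀ ℚ-ring

  -- `Σ<` folds from the first index. The tail of `upTo` is only an `applyUpTo`, so the induction
  -- runs over an arbitrary `g`.
  Σ<-suc : ∀ m f → Σ< (suc m) f ≡ Σ< m f + f m
  Σ<-suc m f = go m id
    where
    go : ∀ m (g : ℕ → ℕ) → foldr (λ k acc → f k + acc) 0ℚ (applyUpTo g (suc m)) ≡ foldr (λ k acc → f k + acc) 0ℚ (applyUpTo g m) + f (g m)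
    go zero    g = +-comm (f (g 0)) 0ℚ
    go (suc m) g = trans (cong (f (g 0) +_) (go m (g ∘ suc))) (sym (+-assoc (f (g 0)) _ _))

  expTerm : ℕ → ℚ → ℚ
  expTerm k s = powℚ s k * frac 1 (k !)

  -- The recurrence behind the inductive estimates on terms, with a factor `ℕtoℚ (suc k)` on the
  -- left in place of a division.
  expTerm-suc : ∀ k s → ℕtoℚ (suc k) * expTerm (suc k) s ≡ s * expTerm k s
  expTerm-suc k s = begin
    ℕtoℚ (suc k) * (s * powℚ s k * frac 1 (suc k !)) ≡⟨ reorder (ℕtoℚ (suc k)) s (powℚ s k) (frac 1 (suc k !)) ⟩
    s * (powℚ s k * (frac 1 (suc k !) * ℕtoℚ (suc k))) ≡⟨ cong (λ q → s * (powℚ s k * q)) (*-cancelˡ-≡ (ℕtoℚ-pos (k !)) inverse) ⟩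
    s * (powℚ s k * frac 1 (k !)) ∎
    where
    open ≡-Reasoning
    instance
      k!≢0 : ℕ.NonZero (k !)
      k!≢0 = k ℕ.!≢0
      [1+k]!≢0 : ℕ.NonZero (suc k !)
      [1+k]!≢0 = suc k ℕ.!≢0
    reorder : ∀ c s p f → c * (s * p * f) ≡ s * (p * (f * c))
    reorder = solve-∀ ℚ-ring
    rotate : ∀ a f c → a * (f * c) ≡ f * (c * a)
    rotate = solve-∀ ℚ-ring
    inverse : ℕtoℚ (k !) * (frac 1 (suc k !) * ℕtoℚ (suc k)) ≡ ℕtoℚ (k !) * frac 1 (k !)
    inverse = begin
      ℕtoℚ (k !) * (frac 1 (suc k !) * ℕtoℚ (suc k))   ≡⟨ rotate (ℕtoℚ (k !)) (frac 1 (suc k !)) (ℕtoℚ (suc k)) ⟩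
      frac 1 (suc k !) * (ℕtoℚ (suc k) * ℕtoℚ (k !))   ≡⟨ cong (frac 1 (suc k !) *_) (sym (ℕtoℚ-* (suc k) (k !))) ⟩
      frac 1 (suc k !) * ℕtoℚ (suc k !)                ≡⟨ frac-*-cancel 1 (suc k !) ⟩
      ℕtoℚ 1                                           ≡⟨ sym (frac-*-cancel 1 (k !)) ⟩
      frac 1 (k !) * ℕtoℚ (k !)                        ≡⟨ *-comm (frac 1 (k !)) (ℕtoℚ (k !)) ⟩
      ℕtoℚ (k !) * frac 1 (k !)                        ∎

  frac-nonNeg : ∀ p d → 0ℚ ≤ frac p d
  frac-nonNeg p zero    = ≤-refl
  frac-nonNeg p (suc d) = nonNegative⁻¹ _ {{normalize-nonNeg p (suc d)}}

  powℚ-nonNeg : ∀ {x} k → 0ℚ ≤ x → 0ℚ ≤ powℚ x k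
  powℚ-nonNeg zero    0≤x = nonNegative⁻¹ 1ℚ
  powℚ-nonNeg (suc k) 0≤x = *-nonNeg 0≤x (powℚ-nonNeg k 0≤x)

  expTerm-nonNeg : ∀ {x} k → 0ℚ ≤ x → 0ℚ ≤ expTerm k x
  expTerm-nonNeg k 0≤x = *-nonNeg (powℚ-nonNeg k 0≤x) (frac-nonNeg 1 (k !))

  ∣*∣-mono : ∀ {p q P Q} → ∣ p ∣ ≤ P → ∣ q ∣ ≤ Q → ∣ p * q ∣ ≤ P * Q
  ∣*∣-mono {p} {q} {P} {Q} hp hq = begin
    ∣ p * q ∣      ≡⟨ ∣p*q∣≡∣p∣*∣q∣ p q ⟩
    ∣ p ∣ * ∣ q ∣  ≤⟨ *-monoʳ (0≤∣p∣ q) hp ⟩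
    P * ∣ q ∣      ≤⟨ *-monoˡ (≤-trans (0≤∣p∣ p) hp) hq ⟩
    P * Q          ∎
    where open ≤-Reasoning

  ∣powℚ∣≤ : ∀ {s x} k → ∣ s ∣ ≤ x → ∣ powℚ s k ∣ ≤ powℚ x k
  ∣powℚ∣≤ zero    h = ≤-refl
  ∣powℚ∣≤ (suc k) h = ∣*∣-mono h (∣powℚ∣≤ k h)

  ∣expTerm∣≤ : ∀ {s x} k → ∣ s ∣ ≤ x → ∣ expTerm k s ∣ ≤ expTerm k x
  ∣expTerm∣≤ k h = ∣*∣-mono (∣powℚ∣≤ k h) (≤-reflexive (0≤p⇒∣p∣≡p (frac-nonNeg 1 (k !))))

  -- The second derivative of `expTerm (suc k)`, which governs the Taylor remainder of that term.
  -- The value `0` at index `0` reflects that `expTerm 1` is linear.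
  prevTerm : ℕ → ℚ → ℚ
  prevTerm zero    x = 0ℚ
  prevTerm (suc k) x = expTerm k x

  prevTerm-suc : ∀ k x → x * prevTerm k x ≡ ℕtoℚ k * expTerm k x
  prevTerm-suc zero    x = trans (*-zeroʳ x) (sym (*-zeroˡ (expTerm 0 x)))
  prevTerm-suc (suc k) x = sym (expTerm-suc k x)

  -- First-order Taylor expansion of the partial sums, dominated at `x`

  module Taylor (x s a : ℚ) (∣s∣≤x : ∣ s ∣ ≤ x) (∣s+a∣≤x : ∣ s + a ∣ ≤ x) where

    0≤x : 0ℚ ≤ x
    0≤x = ≤-trans (0≤∣p∣ s) ∣s∣≤x

    remainder : ℕ → ℚ
    remainder k = expTerm (suc k) (s + a) - expTerm (suc k) s - a * expTerm k s

    -- Multiplying by the degree and applying `expTerm-suc` lowers every degree by one; what does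
    -- not recombine into `remainder k` is the quadratic term. Since `remainder 0` vanishes, bounds
    -- follow by induction.
    remainder-suc : ∀ k → ℕtoℚ (suc (suc k)) * remainder (suc k) ≡ (s + a) * remainder k + a * a * expTerm k s
    remainder-suc k = begin
      n * (u₂ - v₂ - a * v₁)                          ≡⟨ expand n u₂ v₂ (a * v₁) ⟩
      n * u₂ - n * v₂ - n * (a * v₁)                  ≡⟨ cong (λ q → n * u₂ - n * v₂ - q * (a * v₁)) (ℕtoℚ-suc (suc k)) ⟩
      n * u₂ - n * v₂ - (1ℚ + m) * (a * v₁)           ≡⟨ cong₂ (λ p q → p - q - (1ℚ + m) * (a * v₁)) (expTerm-suc (suc k) (s + a)) (expTerm-suc (suc k) s) ⟩
      (s + a) * u₁ - s * v₁ - (1ℚ + m) * (a * v₁)     ≡⟨ isolate s a u₁ v₁ m ⟩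
      (s + a) * u₁ - s * v₁ - a * v₁ - a * (m * v₁)   ≡⟨ cong (λ q → (s + a) * u₁ - s * v₁ - a * v₁ - a * q) (expTerm-suc k s) ⟩
      (s + a) * u₁ - s * v₁ - a * v₁ - a * (s * v₀)   ≡⟨ collect s a u₁ v₁ v₀ ⟩
      (s + a) * (u₁ - v₁ - a * v₀) + a * a * v₀       ∎
      where
      open ≡-Reasoning
      n m u₁ u₂ v₀ v₁ v₂ : ℚ
      n  = ℕtoℚ (suc (suc k))
      m  = ℕtoℚ (suc k)
      u₁ = expTerm (suc k) (s + a)
      u₂ = expTerm (suc (suc k)) (s + a)
      v₀ = expTerm k s
      v₁ = expTerm (suc k) s
      v₂ = expTerm (suc (suc k)) s
      expand : ∀ n p q r → n * (p - q - r) ≡ n * p - n * q - n * r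
      expand = solve-∀ ℚ-ring
      isolate : ∀ s a u v m → (s + a) * u - s * v - (1ℚ + m) * (a * v) ≡ (s + a) * u - s * v - a * v - a * (m * v)
      isolate = solve-∀ ℚ-ring
      collect : ∀ s a u v w → (s + a) * u - s * v - a * v - a * (s * w) ≡ (s + a) * (u - v - a * w) + a * a * w
      collect = solve-∀ ℚ-ring

    0≤a² : 0ℚ ≤ a * a
    0≤a² = subst (0ℚ ≤_) (trans (sym (∣p*q∣≡∣p∣*∣q∣ a a)) (square (∣p∣≡p∨∣p∣≡-p a))) (*-nonNeg (0≤∣p∣ a) (0≤∣p∣ a))
      where
      negSquare : ∀ a → - a * - a ≡ a * a
      negSquare = solve-∀ ℚ-ring
      square : _ → ∣ a * a ∣ ≡ a * a
      square (inj₁ eq) = trans (∣p*q∣≡∣p∣*∣q∣ a a) (cong₂ _*_ eq eq)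
      square (inj₂ eq) = trans (∣p*q∣≡∣p∣*∣q∣ a a) (trans (cong₂ _*_ eq eq) (negSquare a))

    ∣remainder∣≤ : ∀ k → ∣ remainder k ∣ ≤ a * a * prevTerm k x
    ∣remainder∣≤ zero = ≤-reflexive (trans (cong ∣_∣ (vanish s a)) (sym (*-zeroʳ (a * a))))
      where
      vanish : ∀ s a → (s + a) * 1ℚ * 1ℚ - s * 1ℚ * 1ℚ - a * (1ℚ * 1ℚ) ≡ 0ℚ
      vanish = solve-∀ ℚ-ring
    ∣remainder∣≤ (suc k) = *-cancelˡ (ℕtoℚ-pos (suc (suc k))) (begin
      n * ∣ remainder (suc k) ∣                          ≡⟨ cong (_* ∣ remainder (suc k) ∣) (sym (0≤p⇒∣p∣≡p (ℕtoℚ-nonNeg (suc (suc k))))) ⟩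
      ∣ n ∣ * ∣ remainder (suc k) ∣                      ≡⟨ sym (∣p*q∣≡∣p∣*∣q∣ n (remainder (suc k))) ⟩
      ∣ n * remainder (suc k) ∣                          ≡⟨ cong ∣_∣ (remainder-suc k) ⟩
      ∣ (s + a) * remainder k + a * a * expTerm k s ∣    ≤⟨ ∣p+q∣≤∣p∣+∣q∣ ((s + a) * remainder k) (a * a * expTerm k s) ⟩
      ∣ (s + a) * remainder k ∣ + ∣ a * a * expTerm k s ∣
        ≤⟨ +-mono-≤ (∣*∣-mono ∣s+a∣≤x (∣remainder∣≤ k)) (∣*∣-mono (≤-reflexive (0≤p⇒∣p∣≡p 0≤a²)) (∣expTerm∣≤ k ∣s∣≤x)) ⟩
      x * (a * a * prevTerm k x) + a * a * expTerm k x   ≡⟨ pull x (a * a) (prevTerm k x) (expTerm k x) ⟩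
      a * a * (x * prevTerm k x + expTerm k x)           ≡⟨ cong (λ q → a * a * (q + expTerm k x)) (prevTerm-suc k x) ⟩
      a * a * (ℕtoℚ k * expTerm k x + expTerm k x)       ≡⟨ cong (a * a *_) (factor (ℕtoℚ k) (expTerm k x)) ⟩
      a * a * ((1ℚ + ℕtoℚ k) * expTerm k x)              ≡⟨ cong (λ q → a * a * (q * expTerm k x)) (sym (ℕtoℚ-suc k)) ⟩
      -- The recurrence has produced the factor `suc k`; enlarging it to `suc (suc k)` makes it
      -- cancel against the left-hand side.
      a * a * (ℕtoℚ (suc k) * expTerm k x)               ≤⟨ *-monoˡ 0≤a² (*-monoʳ (expTerm-nonNeg k 0≤x) (ℕtoℚ-mono (ℕ.n≤1+n (suc k)))) ⟩
      a * a * (n * expTerm k x)                          ≡⟨ swap (a * a) n (expTerm k x) ⟩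
      n * (a * a * expTerm k x)                          ∎)
      where
      open ≤-Reasoning
      n : ℚ
      n = ℕtoℚ (suc (suc k))
      pull : ∀ x c p q → x * (c * p) + c * q ≡ c * (x * p + q)
      pull = solve-∀ ℚ-ring
      factor : ∀ k e → k * e + e ≡ (1ℚ + k) * e
      factor = solve-∀ ℚ-ring
      swap : ∀ c n e → c * (n * e) ≡ n * (c * e)
      swap = solve-∀ ℚ-ring

    -- The derivative of `expPartial (suc M)` is `expPartial M`, one term shorter, so the expression
    -- is the sum of the termwise remainders.
    ∣expPartial-remainder∣≤ : ∀ M →
      ∣ expPartial (suc M) (s + a) - expPartial (suc M) s - a * expPartial M s ∣ ≤ a * a * Σ< M (λ k → prevTerm k x)
    ∣expPartial-remainder∣≤ zero = ≤-reflexive (trans (cong ∣_∣ (vanish 1ℚ a)) (sym (*-zeroʳ (a * a))))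
      where
      vanish : ∀ e a → e - e - a * 0ℚ ≡ 0ℚ
      vanish = solve-∀ ℚ-ring
    ∣expPartial-remainder∣≤ (suc M) = begin
      ∣ expPartial (suc (suc M)) (s + a) - expPartial (suc (suc M)) s - a * expPartial (suc M) s ∣
        ≡⟨ cong₂ (λ p q → ∣ p - q - a * expPartial (suc M) s ∣) (Σ<-suc (suc M) (λ k → expTerm k (s + a))) (Σ<-suc (suc M) (λ k → expTerm k s)) ⟩
      ∣ (P + u) - (Q + v) - a * expPartial (suc M) s ∣
        ≡⟨ cong (λ q → ∣ (P + u) - (Q + v) - a * q ∣) (Σ<-suc M (λ k → expTerm k s)) ⟩
      ∣ (P + u) - (Q + v) - a * (expPartial M s + expTerm M s) ∣
        ≡⟨ cong ∣_∣ (separate P u Q v a (expPartial M s) (expTerm M s)) ⟩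
      ∣ (P - Q - a * expPartial M s) + remainder M ∣
        ≤⟨ ∣p+q∣≤∣p∣+∣q∣ (P - Q - a * expPartial M s) (remainder M) ⟩
      ∣ P - Q - a * expPartial M s ∣ + ∣ remainder M ∣
        ≤⟨ +-mono-≤ (∣expPartial-remainder∣≤ M) (∣remainder∣≤ M) ⟩
      a * a * Σ< M (λ k → prevTerm k x) + a * a * prevTerm M x
        ≡⟨ sym (*-distribˡ-+ (a * a) (Σ< M (λ k → prevTerm k x)) (prevTerm M x)) ⟩
      a * a * (Σ< M (λ k → prevTerm k x) + prevTerm M x)
        ≡⟨ cong (a * a *_) (sym (Σ<-suc M (λ k → prevTerm k x))) ⟩
      a * a * Σ< (suc M) (λ k → prevTerm k x) ∎
      where
      open ≤-Reasoning
      P Q u v : ℚ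
      P = expPartial (suc M) (s + a)
      Q = expPartial (suc M) s
      u = expTerm (suc M) (s + a)
      v = expTerm (suc M) s
      separate : ∀ P u Q v a f e → (P + u) - (Q + v) - a * (f + e) ≡ (P - Q - a * f) + (u - v - a * e)
      separate = solve-∀ ℚ-ring

    -- A truncated form of exp(s + a) ≈ (1 + a) exp(s). The last summand is the price for putting
    -- `expPartial (suc M) s` in the place of its derivative `expPartial M s`.
    expPartial-step : ∀ M →
      ∣ (1ℚ + a) * expPartial (suc M) s - expPartial (suc M) (s + a) ∣ ≤ a * a * Σ< M (λ k → prevTerm k x) + ∣ a ∣ * expTerm M x
    expPartial-step M = begin
      ∣ (1ℚ + a) * Q - P ∣                                             ≡⟨ cong (λ q → ∣ (1ℚ + a) * q - P ∣) (Σ<-suc M (λ k → expTerm k s)) ⟩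
      ∣ (1ℚ + a) * (f + e) - P ∣                                       ≡⟨ cong ∣_∣ (rearrange a f e P) ⟩
      ∣ - (P - (f + e) - a * f) + a * e ∣                              ≡⟨ cong (λ q → ∣ - (P - q - a * f) + a * e ∣) (sym (Σ<-suc M (λ k → expTerm k s))) ⟩
      ∣ - (P - Q - a * f) + a * e ∣                                    ≤⟨ ∣p+q∣≤∣p∣+∣q∣ (- (P - Q - a * f)) (a * e) ⟩
      ∣ - (P - Q - a * f) ∣ + ∣ a * e ∣                                ≡⟨ cong (_+ ∣ a * e ∣) (∣-p∣≡∣p∣ (P - Q - a * f)) ⟩
      ∣ P - Q - a * f ∣ + ∣ a * e ∣                                    ≤⟨ +-mono-≤ (∣expPartial-remainder∣≤ M) (∣*∣-mono {a} ≤-refl (∣expTerm∣≤ M ∣s∣≤x)) ⟩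
      a * a * Σ< M (λ k → prevTerm k x) + ∣ a ∣ * expTerm M x          ∎
      where
      open ≤-Reasoning
      P Q f e : ℚ
      P = expPartial (suc M) (s + a)
      Q = expPartial (suc M) s
      f = expPartial M s
      e = expTerm M s
      rearrange : ∀ a f e P → (1ℚ + a) * (f + e) - P ≡ - (P - (f + e) - a * f) + a * e
      rearrange = solve-∀ ℚ-ring

  -- Bounds on the terms at `x`, uniform in the index

  expTerm-bounded-below : ∀ {y} → 0ℚ ≤ y → ∀ m → Σ ℚ λ C → ∀ k → k ℕ.≤ m → expTerm k y ≤ C
  expTerm-bounded-below {y} 0≤y zero = expTerm 0 y , λ { zero _ → ≤-refl }
  expTerm-bounded-below {y} 0≤y (suc m) with expTerm-bounded-below 0≤y m
  ... | C , bound = C ⊔ expTerm (suc m) y , λ k k≤1+m →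
    [ (λ k<1+m → ≤-trans (bound k (ℕ.s≤s⁻¹ k<1+m)) (p≤p⊔q C _))
    , (λ { refl → p≤q⊔p C _ }) ]′ (ℕ.m≤n⇒m<n∨m≡n k≤1+m)

  -- Beyond the index ⌈y⌉ the terms decrease.
  expTerm-bounded : ∀ {y} → 0ℚ ≤ y → Σ ℚ λ C → 0ℚ ≤ C × (∀ k → expTerm k y ≤ C)
  expTerm-bounded {y} 0≤y with archimedean y
  ... | Y , y≤Y with expTerm-bounded-below 0≤y Y
  ...   | C , initial = C , ≤-trans (expTerm-nonNeg 0 0≤y) (initial 0 ℕ.z≤n) , bound
    where
    bound : ∀ k → expTerm k y ≤ C
    bound zero    = initial 0 ℕ.z≤n
    bound (suc k) with ℕ.≤-total (suc k) Y
    ... | inj₁ k<Y = initial (suc k) k<Y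
    ... | inj₂ Y≤k = *-cancelˡ (ℕtoℚ-pos (suc k)) (begin
      ℕtoℚ (suc k) * expTerm (suc k) y  ≡⟨ expTerm-suc k y ⟩
      y * expTerm k y                   ≤⟨ *-monoʳ (expTerm-nonNeg k 0≤y) (≤-trans y≤Y (ℕtoℚ-mono Y≤k)) ⟩
      ℕtoℚ (suc k) * expTerm k y        ≤⟨ *-monoˡ (ℕtoℚ-nonNeg (suc k)) (bound k) ⟩
      ℕtoℚ (suc k) * C                  ∎)
      where open ≤-Reasoning

  powℚ-* : ∀ x y k → powℚ (x * y) k ≡ powℚ x k * powℚ y k
  powℚ-* x y zero    = refl
  powℚ-* x y (suc k) = trans (cong (x * y *_) (powℚ-* x y k)) (interchange x y (powℚ x k) (powℚ y k))
    where
    interchange : ∀ x y p q → x * y * (p * q) ≡ x * p * (y * q)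
    interchange = solve-∀ ℚ-ring

  -- The term at `x` is `powℚ ½ k` times the term at `x + x`, so mere boundedness at the doubled
  -- point gives geometric decay.
  expTerm-geometric : ∀ {x} → 0ℚ ≤ x → Σ ℚ λ C → 0ℚ ≤ C × (∀ k → expTerm k x ≤ C * powℚ ½ k)
  expTerm-geometric {x} 0≤x with expTerm-bounded (+-nonNeg 0≤x 0≤x)
  ... | C , 0≤C , bound = C , 0≤C , λ k → begin
    powℚ x k * frac 1 (k !)                         ≡⟨ cong (λ q → powℚ q k * frac 1 (k !)) (halve x) ⟩
    powℚ (½ * (x + x)) k * frac 1 (k !)             ≡⟨ cong (_* frac 1 (k !)) (powℚ-* ½ (x + x) k) ⟩
    powℚ ½ k * powℚ (x + x) k * frac 1 (k !)        ≡⟨ *-assoc (powℚ ½ k) _ _ ⟩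
    powℚ ½ k * expTerm k (x + x)                    ≤⟨ *-monoˡ (powℚ-nonNeg k (nonNegative⁻¹ ½)) (bound k) ⟩
    powℚ ½ k * C                                    ≡⟨ *-comm (powℚ ½ k) C ⟩
    C * powℚ ½ k                                    ∎
    where
    open ≤-Reasoning
    halve : ∀ x → x ≡ ½ * (x + x)
    halve x = trans (sym (*-identityˡ x)) (trans (*-distribʳ-+ x ½ ½) (sym (*-distribˡ-+ ½ x x)))

  [1+k]/2^k≤1 : ∀ k → ℕtoℚ (suc k) * powℚ ½ k ≤ 1ℚ
  [1+k]/2^k≤1 zero    = ≤-refl
  [1+k]/2^k≤1 (suc k) = begin
    ℕtoℚ (suc (suc k)) * (½ * powℚ ½ k)             ≡⟨ cong (_* (½ * powℚ ½ k)) (ℕtoℚ-suc (suc k)) ⟩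
    (1ℚ + ℕtoℚ (suc k)) * (½ * powℚ ½ k)            ≤⟨ *-monoʳ (*-nonNeg {½} (nonNegative⁻¹ ½) (powℚ-nonNeg k (nonNegative⁻¹ ½))) (+-monoˡ-≤ (ℕtoℚ (suc k)) (ℕtoℚ-mono {1} {suc k} (ℕ.s≤s ℕ.z≤n))) ⟩
    (ℕtoℚ (suc k) + ℕtoℚ (suc k)) * (½ * powℚ ½ k)  ≡⟨ regroup (ℕtoℚ (suc k)) ½ (powℚ ½ k) ⟩
    (½ + ½) * (ℕtoℚ (suc k) * powℚ ½ k)             ≡⟨ *-identityˡ _ ⟩
    ℕtoℚ (suc k) * powℚ ½ k                         ≤⟨ [1+k]/2^k≤1 k ⟩
    1ℚ                                              ∎
    where
    open ≤-Reasoning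
    regroup : ∀ m h p → (m + m) * (h * p) ≡ (h + h) * (m * p)
    regroup = solve-∀ ℚ-ring

  -- The exact geometric sum is kept because the induction would not close with the bound `C + C`
  -- alone.
  prevTerm-sum : ∀ {x C} → (∀ k → expTerm k x ≤ C * powℚ ½ k) → ∀ M →
    Σ< (suc M) (λ k → prevTerm k x) ≤ (C + C) * (1ℚ - powℚ ½ M)
  prevTerm-sum {x} {C} bound zero = ≤-reflexive (sym (*-zeroʳ (C + C)))
  prevTerm-sum {x} {C} bound (suc M) = begin
    Σ< (suc (suc M)) (λ k → prevTerm k x)              ≡⟨ Σ<-suc (suc M) (λ k → prevTerm k x) ⟩
    Σ< (suc M) (λ k → prevTerm k x) + expTerm M x      ≤⟨ +-mono-≤ (prevTerm-sum {x} {C} bound M) (bound M) ⟩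
    (C + C) * (1ℚ - h) + C * h                         ≡⟨ cong (λ q → (C + C) * (1ℚ - h) + q) (sym (*-identityˡ (C * h))) ⟩
    (C + C) * (1ℚ - h) + (½ + ½) * (C * h)             ≡⟨ regroup C h ½ ⟩
    (C + C) * (1ℚ - h) + (C + C) * (½ * h)             ≡⟨ cong (λ q → (C + C) * (1ℚ - q) + (C + C) * (½ * h)) (sym (trans (sym (*-distribʳ-+ h ½ ½)) (*-identityˡ h))) ⟩
    (C + C) * (1ℚ - (½ * h + ½ * h)) + (C + C) * (½ * h) ≡⟨ cancel (C + C) (½ * h) ⟩
    (C + C) * (1ℚ - ½ * h)                             ∎
    where
    open ≤-Reasoning
    h : ℚ
    h = powℚ ½ M
    regroup : ∀ C h e → (C + C) * (1ℚ - h) + (e + e) * (C * h) ≡ (C + C) * (1ℚ - h) + (C + C) * (e * h)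
    regroup = solve-∀ ℚ-ring
    cancel : ∀ D q → D * (1ℚ - (q + q)) + D * q ≡ D * (1ℚ - q)
    cancel = solve-∀ ℚ-ring

  -- One constant for the two quantities in the error: the sum that multiplies the quadratic
  -- remainder, and the truncation term. The geometric decay of the latter is weakened to order 1/m,
  -- so that it scales with `N` as the other error does.
  expTerm-tail : ∀ {x} → 0ℚ ≤ x → Σ ℚ λ C → 0ℚ ≤ C ×
    (∀ m → Σ< (suc m) (λ k → prevTerm k x) ≤ C + C) × (∀ m → ℕtoℚ (suc m) * expTerm m x ≤ C)
  expTerm-tail {x} 0≤x with expTerm-geometric 0≤x
  ... | C , 0≤C , bound = C , 0≤C
    , (λ m → ≤-trans (prevTerm-sum {x} {C} bound m) (subst ((C + C) * (1ℚ - powℚ ½ m) ≤_) (*-identityʳ (C + C))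
        (*-monoˡ (+-nonNeg 0≤C 0≤C) (p-q≤p (powℚ-nonNeg m (nonNegative⁻¹ ½))))))
    , λ m → begin
        ℕtoℚ (suc m) * expTerm m x         ≤⟨ *-monoˡ (ℕtoℚ-nonNeg (suc m)) (bound m) ⟩
        ℕtoℚ (suc m) * (C * powℚ ½ m)      ≡⟨ swap (ℕtoℚ (suc m)) C (powℚ ½ m) ⟩
        C * (ℕtoℚ (suc m) * powℚ ½ m)      ≤⟨ *-monoˡ 0≤C ([1+k]/2^k≤1 m) ⟩
        C * 1ℚ                             ≡⟨ *-identityʳ C ⟩
        C                                  ∎
    where
    open ≤-Reasoning
    swap : ∀ n c p → n * (c * p) ≡ c * (n * p)
    swap = solve-∀ ℚ-ring

  -- The birthday product (distinct letters, for `a = 1/B`) and its exponent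

  fallingProduct : ℚ → ℕ → ℚ
  fallingProduct a zero    = 1ℚ
  fallingProduct a (suc i) = fallingProduct a i * (1ℚ - ℕtoℚ i * a)

  triangle : ℚ → ℕ → ℚ
  triangle a zero    = 0ℚ
  triangle a (suc i) = triangle a i + ℕtoℚ i * a

  -- The value i(i-1)a/2, written without division or subtraction. Dropping `ℕtoℚ i * a` bounds the
  -- exponent by `x`; keeping it gives the exact gap at `i = n`.
  triangle-closed : ∀ a i → (triangle a i + triangle a i) + ℕtoℚ i * a ≡ ℕtoℚ i * ℕtoℚ i * a
  triangle-closed a zero    = vanish a
    where
    vanish : ∀ a → (0ℚ + 0ℚ) + 0ℚ * a ≡ 0ℚ * 0ℚ * a
    vanish = solve-∀ ℚ-ring
  triangle-closed a (suc i) rewrite ℕtoℚ-suc i = begin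
    (t + m * a + (t + m * a)) + (1ℚ + m) * a     ≡⟨ peel t m a ⟩
    (t + t + m * a) + (m + m + 1ℚ) * a           ≡⟨ cong (_+ (m + m + 1ℚ) * a) (triangle-closed a i) ⟩
    m * m * a + (m + m + 1ℚ) * a                 ≡⟨ square m a ⟩
    (1ℚ + m) * (1ℚ + m) * a                      ∎
    where
    open ≡-Reasoning
    t m : ℚ
    t = triangle a i
    m = ℕtoℚ i
    peel : ∀ t m a → (t + m * a + (t + m * a)) + (1ℚ + m) * a ≡ (t + t + m * a) + (m + m + 1ℚ) * a
    peel = solve-∀ ℚ-ring
    square : ∀ m a → m * m * a + (m + m + 1ℚ) * a ≡ (1ℚ + m) * (1ℚ + m) * a
    square = solve-∀ ℚ-ring

  -- The old error is multiplied by `1 - β`, hence does not grow; the new one comes from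
  -- `expPartial-step` at `- t` with increment `- β`. One factor of `β * β` is replaced by the
  -- uniform bound `η`, which makes the new error linear in `β`: over all factors it adds up to a
  -- multiple of the total exponent.
  approximation-step : ∀ {x η S t β P E} M →
    0ℚ ≤ t → 0ℚ ≤ β → β ≤ η → β ≤ 1ℚ → t + β ≤ x →
    Σ< M (λ k → prevTerm k x) ≤ S →
    ∣ P - expPartial (suc M) (- t) ∣ ≤ E →
    ∣ P * (1ℚ - β) - expPartial (suc M) (- (t + β)) ∣ ≤ E + β * (η * S + expTerm M x)
  approximation-step {x} {η} {S} {t} {β} {P} {E} M 0≤t 0≤β β≤η β≤1 t+β≤x sum≤S ∣P-f∣≤E = begin
    ∣ P * (1ℚ - β) - g ∣                                   ≡⟨ cong ∣_∣ (insert P β f g) ⟩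
    ∣ (P - f) * (1ℚ - β) + ((1ℚ + - β) * f - g) ∣          ≤⟨ ∣p+q∣≤∣p∣+∣q∣ ((P - f) * (1ℚ - β)) ((1ℚ + - β) * f - g) ⟩
    ∣ (P - f) * (1ℚ - β) ∣ + ∣ (1ℚ + - β) * f - g ∣        ≤⟨ +-mono-≤ (∣*∣-mono ∣P-f∣≤E (≤-trans (≤-reflexive (0≤p⇒∣p∣≡p (0≤q-p β≤1))) (p-q≤p 0≤β))) taylor ⟩
    E * 1ℚ + (β * β * S′ + β * δ)                          ≤⟨ +-mono-≤ (≤-reflexive (*-identityʳ E)) (+-monoˡ-≤ (β * δ) quadratic) ⟩
    E + (β * (η * S) + β * δ)                              ≡⟨ cong (E +_) (sym (*-distribˡ-+ β (η * S) δ)) ⟩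
    E + β * (η * S + δ)                                    ∎
    where
    open ≤-Reasoning
    f g S′ δ : ℚ
    f  = expPartial (suc M) (- t)
    g  = expPartial (suc M) (- (t + β))
    S′ = Σ< M (λ k → prevTerm k x)
    δ  = expTerm M x
    insert : ∀ P β f g → P * (1ℚ - β) - g ≡ (P - f) * (1ℚ - β) + ((1ℚ + - β) * f - g)
    insert = solve-∀ ℚ-ring
    ∣-∣≤ : ∀ {u} → 0ℚ ≤ u → u ≤ x → ∣ - u ∣ ≤ x
    ∣-∣≤ {u} 0≤u u≤x = ≤-trans (≤-reflexive (trans (∣-p∣≡∣p∣ u) (0≤p⇒∣p∣≡p 0≤u))) u≤x
    -t-β : - t + - β ≡ - (t + β)
    -t-β = sym (neg-distrib-+ t β)
    0≤x : 0ℚ ≤ x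
    0≤x = ≤-trans (+-nonNeg 0≤t 0≤β) t+β≤x
    t≤x : t ≤ x
    t≤x = ≤-trans (subst (_≤ t + β) (+-identityʳ t) (+-monoʳ-≤ t 0≤β)) t+β≤x
    negSquare : ∀ β → - β * - β ≡ β * β
    negSquare = solve-∀ ℚ-ring
    taylor : ∣ (1ℚ + - β) * f - g ∣ ≤ β * β * S′ + β * δ
    taylor = subst₂ _≤_
      (cong (λ q → ∣ (1ℚ + - β) * f - expPartial (suc M) q ∣) -t-β)
      (cong₂ (λ p q → p * S′ + q * δ) (negSquare β) (trans (∣-p∣≡∣p∣ β) (0≤p⇒∣p∣≡p 0≤β)))
      (Taylor.expPartial-step x (- t) (- β) (∣-∣≤ 0≤t t≤x)
        (subst (λ q → ∣ q ∣ ≤ x) (sym -t-β) (∣-∣≤ (+-nonNeg 0≤t 0≤β) t+β≤x)) M)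
    prevTerm-nonNeg : ∀ k → 0ℚ ≤ prevTerm k x
    prevTerm-nonNeg zero    = ≤-refl
    prevTerm-nonNeg (suc k) = expTerm-nonNeg k 0≤x
    Σ<-nonNeg : ∀ m → 0ℚ ≤ Σ< m (λ k → prevTerm k x)
    Σ<-nonNeg zero    = ≤-refl
    Σ<-nonNeg (suc m) = subst (0ℚ ≤_) (sym (Σ<-suc m (λ k → prevTerm k x))) (+-nonNeg (Σ<-nonNeg m) (prevTerm-nonNeg m))
    quadratic : β * β * S′ ≤ β * (η * S)
    quadratic = begin
      β * β * S′    ≡⟨ *-assoc β β S′ ⟩
      β * (β * S′)  ≤⟨ *-monoˡ 0≤β (*-monoʳ (Σ<-nonNeg M) β≤η) ⟩
      β * (η * S′)  ≤⟨ *-monoˡ 0≤β (*-monoˡ (≤-trans 0≤β β≤η) sum≤S) ⟩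
      β * (η * S)   ∎

  module _ {a x S : ℚ} {n : ℕ} (M : ℕ)
    (0≤a : 0ℚ ≤ a) (na≤1 : ℕtoℚ n * a ≤ 1ℚ) (2x : x + x ≡ ℕtoℚ n * ℕtoℚ n * a)
    (sum≤S : Σ< M (λ k → prevTerm k x) ≤ S) where

    private
      η κ : ℚ
      η = ℕtoℚ n * a
      κ = η * S + expTerm M x

    ia-nonNeg : ∀ i → 0ℚ ≤ ℕtoℚ i * a
    ia-nonNeg i = *-nonNeg (ℕtoℚ-nonNeg i) 0≤a

    triangle-nonNeg : ∀ i → 0ℚ ≤ triangle a i
    triangle-nonNeg zero    = ≤-refl
    triangle-nonNeg (suc i) = +-nonNeg (triangle-nonNeg i) (ia-nonNeg i)

    triangle≤x : ∀ i → i ℕ.≤ n → triangle a i ≤ x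
    triangle≤x i i≤n = double-cancel (begin
      t + t                       ≡⟨ sym (+-identityʳ (t + t)) ⟩
      t + t + 0ℚ                  ≤⟨ +-monoʳ-≤ (t + t) (ia-nonNeg i) ⟩
      t + t + ℕtoℚ i * a          ≡⟨ triangle-closed a i ⟩
      ℕtoℚ i * ℕtoℚ i * a         ≤⟨ *-monoʳ 0≤a (≤-trans (*-monoʳ (ℕtoℚ-nonNeg i) (ℕtoℚ-mono i≤n)) (*-monoˡ (ℕtoℚ-nonNeg n) (ℕtoℚ-mono i≤n))) ⟩
      ℕtoℚ n * ℕtoℚ n * a         ≡⟨ sym 2x ⟩
      x + x                       ∎)
      where
      open ≤-Reasoning
      t : ℚ
      t = triangle a i

    ia≤η : ∀ i → i ℕ.≤ n → ℕtoℚ i * a ≤ η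
    ia≤η i i≤n = *-monoʳ 0≤a (ℕtoℚ-mono i≤n)

    approximation : ∀ i → i ℕ.≤ n →
      ∣ fallingProduct a i - expPartial (suc M) (- triangle a i) ∣ ≤ triangle a i * κ
    approximation zero    _   = ≤-reflexive (trans (cong ∣_∣ start) (sym (*-zeroˡ κ)))
      where
      expPartial-0 : ∀ m → expPartial (suc m) 0ℚ ≡ 1ℚ
      expPartial-0 zero    = refl
      expPartial-0 (suc m) = trans (Σ<-suc (suc m) (λ k → expTerm k 0ℚ))
        (trans (cong₂ _+_ (expPartial-0 m) (trans (cong (_* frac 1 (suc m !)) (*-zeroˡ (powℚ 0ℚ m))) (*-zeroˡ (frac 1 (suc m !))))) (+-identityʳ 1ℚ))
      start : 1ℚ - expPartial (suc M) (- 0ℚ) ≡ 0ℚ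
      start = cong (λ q → 1ℚ - q) (expPartial-0 M)
    approximation (suc i) i<n = ≤-trans
      (approximation-step {P = fallingProduct a i} M (triangle-nonNeg i) (ia-nonNeg i) (ia≤η i (ℕ.<⇒≤ i<n)) (≤-trans (ia≤η i (ℕ.<⇒≤ i<n)) na≤1)
        (triangle≤x (suc i) i<n) sum≤S (approximation i (ℕ.<⇒≤ i<n)))
      (≤-reflexive (sym (*-distribʳ-+ κ (triangle a i) (ℕtoℚ i * a))))

    fallingProduct-nonNeg : ∀ i → i ℕ.≤ n → 0ℚ ≤ fallingProduct a i
    fallingProduct-nonNeg zero    _   = nonNegative⁻¹ 1ℚ
    fallingProduct-nonNeg (suc i) i<n = *-nonNeg (fallingProduct-nonNeg i (ℕ.<⇒≤ i<n)) (0≤q-p (≤-trans (ia≤η i (ℕ.<⇒≤ i<n)) na≤1))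

    fallingProduct≤1 : ∀ i → i ℕ.≤ n → fallingProduct a i ≤ 1ℚ
    fallingProduct≤1 zero    _   = ≤-refl
    fallingProduct≤1 (suc i) i<n = begin
      fallingProduct a i * (1ℚ - ℕtoℚ i * a) ≤⟨ *-monoˡ (fallingProduct-nonNeg i (ℕ.<⇒≤ i<n)) (p-q≤p (ia-nonNeg i)) ⟩
      fallingProduct a i * 1ℚ                ≡⟨ *-identityʳ _ ⟩
      fallingProduct a i                     ≤⟨ fallingProduct≤1 i (ℕ.<⇒≤ i<n) ⟩
      1ℚ                                     ∎
      where open ≤-Reasoning

    -- An extra factor 1 - β with β = x - n(n-1)a/2 = na/2 brings the exponent to x exactly.
    fallingProduct-approximation :
      ∣ fallingProduct a n - expPartial (suc M) (- x) ∣ ≤ ℕtoℚ n * a + x * (ℕtoℚ n * a * S + expTerm M x)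
    fallingProduct-approximation = begin
      ∣ P - f ∣                                       ≡⟨ cong ∣_∣ (insert P β f) ⟩
      ∣ P * β + (P * (1ℚ - β) - f) ∣                  ≤⟨ ∣p+q∣≤∣p∣+∣q∣ (P * β) (P * (1ℚ - β) - f) ⟩
      ∣ P * β ∣ + ∣ P * (1ℚ - β) - f ∣                ≤⟨ +-mono-≤ (∣*∣-mono ∣P∣≤1 (≤-trans (≤-reflexive (0≤p⇒∣p∣≡p 0≤β)) β≤η)) extra ⟩
      1ℚ * η + (t * κ + β * κ)                        ≡⟨ cong₂ _+_ (*-identityˡ η) (trans (sym (*-distribʳ-+ κ t β)) (cong (_* κ) t+β≡x)) ⟩
      η + x * κ                                       ∎
      where
      open ≤-Reasoning
      P f t β : ℚ
      P = fallingProduct a n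
      f = expPartial (suc M) (- x)
      t = triangle a n
      β = x - t
      insert : ∀ P β f → P - f ≡ P * β + (P * (1ℚ - β) - f)
      insert = solve-∀ ℚ-ring
      restore : ∀ t x → t + (x - t) ≡ x
      restore = solve-∀ ℚ-ring
      t+β≡x : t + β ≡ x
      t+β≡x = restore t x
      0≤β : 0ℚ ≤ β
      0≤β = 0≤q-p (triangle≤x n ℕ.≤-refl)
      double : ∀ x t → (x - t) + (x - t) ≡ (x + x) - (t + t)
      double = solve-∀ ℚ-ring
      difference : ∀ t e → (t + t + e) - (t + t) ≡ e
      difference = solve-∀ ℚ-ring
      β+β≡η : β + β ≡ η
      β+β≡η = trans (double x t) (trans (cong (_- (t + t)) (trans 2x (sym (triangle-closed a n)))) (difference t η))
      β≤η : β ≤ η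
      β≤η = subst₂ _≤_ (+-identityʳ β) β+β≡η (+-monoʳ-≤ β 0≤β)
      ∣P∣≤1 : ∣ P ∣ ≤ 1ℚ
      ∣P∣≤1 = ≤-trans (≤-reflexive (0≤p⇒∣p∣≡p (fallingProduct-nonNeg n ℕ.≤-refl))) (fallingProduct≤1 n ℕ.≤-refl)
      extra : ∣ P * (1ℚ - β) - f ∣ ≤ t * κ + β * κ
      extra = subst (λ q → ∣ P * (1ℚ - β) - expPartial (suc M) (- q) ∣ ≤ t * κ + β * κ) t+β≡x
        (approximation-step {P = P} M (triangle-nonNeg n) 0≤β β≤η (≤-trans β≤η na≤1) (≤-reflexive t+β≡x) sum≤S (approximation n ℕ.≤-refl))

  -- `N` times the bound of `fallingProduct-approximation` with `S = C + C`, after `N * (n * a)` is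
  -- estimated by `x + x` and `N` times the truncation term by `C`.
  errorConstant : ℚ → ℚ → ℚ
  errorConstant x C = (x + x) + x * ((x + x) * (C + C) + C)

  -- The quadratic scaling enters here: `n * (n * a) = x + x` makes `n * a` of order 1/n, and
  -- `x + x ≤ N ≤ n` makes it at most 1, so that every factor of the product lies between 0 and 1.
  fallingProduct-error : ∀ {x C a} N n m .{{_ : ℕ.NonZero n}} → 0ℚ ≤ x → 0ℚ ≤ C → 0ℚ ≤ a → x + x ≡ ℕtoℚ n * ℕtoℚ n * a →
    Σ< (suc m) (λ k → prevTerm k x) ≤ C + C → ℕtoℚ (suc (suc m)) * expTerm (suc m) x ≤ C →
    x + x ≤ ℕtoℚ N → N ℕ.≤ n → N ℕ.≤ suc (suc m) →
    ℕtoℚ N * ∣ fallingProduct a n - expPartial (suc (suc m)) (- x) ∣ ≤ errorConstant x C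
  fallingProduct-error {x} {C} {a} N n m 0≤x 0≤C 0≤a 2x sum≤ term≤ 2x≤N N≤n N≤M = begin
    ν * ∣ fallingProduct a n - expPartial (suc (suc m)) (- x) ∣
      ≤⟨ *-monoˡ 0≤ν (fallingProduct-approximation {n = n} (suc m) 0≤a na≤1 2x sum≤) ⟩
    ν * (η + x * (η * (C + C) + δ))
      ≡⟨ distribute ν η x (C + C) δ ⟩
    ν * η + x * (ν * η * (C + C) + ν * δ)
      ≤⟨ +-mono-≤ νη≤2x (*-monoˡ 0≤x (+-mono-≤ (*-monoʳ (+-nonNeg 0≤C 0≤C) νη≤2x) νδ≤C)) ⟩
    errorConstant x C ∎
    where
    open ≤-Reasoning
    ν η δ : ℚ
    ν = ℕtoℚ N
    η = ℕtoℚ n * a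
    δ = expTerm (suc m) x
    0≤ν : 0ℚ ≤ ν
    0≤ν = ℕtoℚ-nonNeg N
    nη≡2x : ℕtoℚ n * η ≡ x + x
    nη≡2x = trans (sym (*-assoc (ℕtoℚ n) (ℕtoℚ n) a)) (sym 2x)
    νη≤2x : ν * η ≤ x + x
    νη≤2x = ≤-trans (*-monoʳ (*-nonNeg (ℕtoℚ-nonNeg n) 0≤a) (ℕtoℚ-mono N≤n)) (≤-reflexive nη≡2x)
    νδ≤C : ν * δ ≤ C
    νδ≤C = ≤-trans (*-monoʳ (expTerm-nonNeg (suc m) 0≤x) (ℕtoℚ-mono N≤M)) term≤
    na≤1 : η ≤ 1ℚ
    na≤1 = *-cancelˡ (ℕtoℚ-pos n) (begin
      ℕtoℚ n * η   ≡⟨ nη≡2x ⟩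
      x + x        ≤⟨ 2x≤N ⟩
      ℕtoℚ N       ≤⟨ ℕtoℚ-mono N≤n ⟩
      ℕtoℚ n       ≡⟨ sym (*-identityʳ (ℕtoℚ n)) ⟩
      ℕtoℚ n * 1ℚ  ∎)
    distribute : ∀ ν η x D δ → ν * (η + x * (η * D + δ)) ≡ ν * η + x * (ν * η * D + ν * δ)
    distribute = solve-∀ ℚ-ring

  archimedean-< : ∀ G {ε} → 0ℚ < ε → Σ ℕ λ N → G < ℕtoℚ N * ε
  archimedean-< G {ε} 0<ε = suc K , (begin-strict
    G                   ≡⟨ sym (trans (*-assoc G (1/ ε) ε) (trans (cong (G *_) (*-inverseˡ ε)) (*-identityʳ G))) ⟩
    G * (1/ ε) * ε      ≤⟨ *-monoʳ (<⇒≤ 0<ε) (proj₂ (archimedean (G * (1/ ε)))) ⟩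
    ℕtoℚ K * ε          <⟨ *-monoˡ-<-pos ε K<1+K ⟩
    ℕtoℚ (suc K) * ε    ∎)
    where
    open ≤-Reasoning
    instance
      ε-pos : Positive ε
      ε-pos = positive 0<ε
      ε-nonZero : NonZero ε
      ε-nonZero = pos⇒nonZero ε
    K : ℕ
    K = proj₁ (archimedean (G * (1/ ε)))
    K<1+K : ℕtoℚ K < ℕtoℚ (suc K)
    K<1+K = subst₂ _<_ (+-identityˡ (ℕtoℚ K)) (sym (ℕtoℚ-suc K)) (+-monoˡ-< (ℕtoℚ K) (positive⁻¹ 1ℚ))

  fallingProduct-limit : ∀ {x ε} → 0ℚ ≤ x → 0ℚ < ε → Σ ℕ λ N →
    ∀ n a → N ℕ.≤ n → 2 ℕ.≤ n → 0ℚ ≤ a → x + x ≡ ℕtoℚ n * ℕtoℚ n * a → ∀ M → N ℕ.≤ M →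
    ∣ fallingProduct a n - expPartial M (- x) ∣ < ε
  -- `2` lets `M` be written `suc (suc m)`, `N₁` keeps the factors nonnegative, and `N₂` beats the
  -- error constant by `ε`.
  fallingProduct-limit {x} {ε} 0≤x 0<ε = 2 ℕ.⊔ (N₁ ℕ.⊔ N₂) , λ n a N≤n 2≤n 0≤a 2x M N≤M →
    conclude (N₁ ℕ.⊔ N₂) (ℕ.m≤m⊔n N₁ N₂) (ℕ.m≤n⊔m N₁ N₂) n a (ℕ.m⊔n≤o⇒n≤o 2 (N₁ ℕ.⊔ N₂) N≤n) 2≤n 0≤a 2x M
      (ℕ.m⊔n≤o⇒m≤o 2 (N₁ ℕ.⊔ N₂) N≤M) (ℕ.m⊔n≤o⇒n≤o 2 (N₁ ℕ.⊔ N₂) N≤M)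
    where
    open ≤-Reasoning
    C : ℚ
    C = proj₁ (expTerm-tail 0≤x)
    N₁ N₂ : ℕ
    N₁ = proj₁ (archimedean (x + x))
    N₂ = proj₁ (archimedean-< (errorConstant x C) 0<ε)
    conclude : ∀ N → N₁ ℕ.≤ N → N₂ ℕ.≤ N → ∀ n a → N ℕ.≤ n → 2 ℕ.≤ n → 0ℚ ≤ a → x + x ≡ ℕtoℚ n * ℕtoℚ n * a →
      ∀ M → 2 ℕ.≤ M → N ℕ.≤ M → ∣ fallingProduct a n - expPartial M (- x) ∣ < ε
    conclude N N₁≤N N₂≤N n a N≤n 2≤n 0≤a 2x M@(suc (suc m)) _ N≤M = *-cancelˡ-<-nonNeg (ℕtoℚ N) {{nonNegative (ℕtoℚ-nonNeg N)}} {q = ε} (begin-strict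
      ℕtoℚ N * ∣ fallingProduct a n - expPartial M (- x) ∣
        ≤⟨ fallingProduct-error N n m {{ℕ.>-nonZero (ℕ.≤-trans (ℕ.s≤s ℕ.z≤n) 2≤n)}} 0≤x (proj₁ (proj₂ (expTerm-tail 0≤x))) 0≤a 2x
             (proj₁ (proj₂ (proj₂ (expTerm-tail 0≤x))) m) (proj₂ (proj₂ (proj₂ (expTerm-tail 0≤x))) (suc m))
             (≤-trans (proj₂ (archimedean (x + x))) (ℕtoℚ-mono N₁≤N)) N≤n N≤M ⟩
      errorConstant x C
        <⟨ proj₂ (archimedean-< (errorConstant x C) 0<ε) ⟩
      ℕtoℚ N₂ * ε
        ≤⟨ *-monoʳ {ε} {ℕtoℚ N₂} {ℕtoℚ N} (<⇒≤ 0<ε) (ℕtoℚ-mono N₂≤N) ⟩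
      ℕtoℚ N * ε ∎)
    conclude N _ _ n a _ _ _ _ (suc zero) (ℕ.s≤s ()) _

-- From powers of the transition matrix to word counts

module SeparationDistance where

  open CarriesAndDescents
  open ExponentialLimit
  import Data.Nat as ℕ
  import Data.Nat.DivMod as ℕ
  import Data.Nat.Properties as ℕ
  open import Data.Nat using (ℕ; zero; suc; _!)
  open import Data.Nat.Combinatorics using (_C_)
  open import Data.Nat.ListAction using (sum)
  import Data.Integer as ℤ
  import Data.Bool as Bool
  open import Data.List using (foldr; applyUpTo; length; filter)
  open import Data.Rational hiding (floor)
  open import Data.Rational.Properties
  open import Data.Product using (Σ; _×_; _,_; proj₁; proj₂)
  open import Function using (id; _∘_)
  open import Relation.Nullary using (yes; no)
  open import Relation.Nullary.Decidable using (⌊_⌋)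
  open import Relation.Binary.PropositionalEquality
  open import Tactic.RingSolver using (solve-∀)

  Σ<-cast : ∀ m {c : ℚ} {f : ℕ → ℚ} (g : ℕ → ℕ) → (∀ k → f k * c ≡ ℕtoℚ (g k)) → Σ< m f * c ≡ ℕtoℚ (∑ m g)
  Σ<-cast zero    {c}     g h = *-zeroˡ c
  Σ<-cast (suc m) {c} {f} g h = begin
    Σ< (suc m) f * c             ≡⟨ cong (_* c) (Σ<-suc m f) ⟩
    (Σ< m f + f m) * c           ≡⟨ *-distribʳ-+ c (Σ< m f) (f m) ⟩
    Σ< m f * c + f m * c         ≡⟨ cong₂ _+_ (Σ<-cast m {f = f} g h) (h m) ⟩
    ℕtoℚ (∑ m g) + ℕtoℚ (g m)    ≡⟨ sym (ℕtoℚ-+ (∑ m g) (g m)) ⟩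
    ℕtoℚ (∑ (suc m) g)           ∎
    where open ≡-Reasoning

  ^-distribʳ-* : ∀ k m n → (m ℕ.* n) ℕ.^ k ≡ m ℕ.^ k ℕ.* n ℕ.^ k
  ^-distribʳ-* zero    m n = refl
  ^-distribʳ-* (suc k) m n = trans (cong (m ℕ.* n ℕ.*_) (^-distribʳ-* k m n)) (ℕ.[m*n]*[o*p]≡[m*o]*[n*p] m n (m ℕ.^ k) (n ℕ.^ k))

  module _ (b : ℕ) .{{_ : ℕ.NonZero b}} where

    carriesP-cast : ∀ n k j → carriesP b n k j * ℕtoℚ (b ℕ.^ n) ≡ ℕtoℚ (∑ʷ b n (λ z → ⟦ ⌊ (k ℕ.+ sum z) ℕ./ b ℕ.≟ j ⌋ ⟧))
    carriesP-cast n k j = trans (frac-*-cancel count (b ℕ.^ n) {{ℕ.m^n≢0 b n}}) (cong ℕtoℚ (begin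
      count
        ≡⟨ length-filter (λ xs → inCarryWindow b k j xs Bool.≟ Bool.true) (tuples b n) ⟩
      _ ≡⟨ sum-tuples b n _ ⟩
      _ ≡⟨ ∑ʷ-cong b n (λ z _ → cong ⟦_⟧ (trans (does-≟true (inCarryWindow b k j z)) (window≡quotient b j (k ℕ.+ sum z)))) ⟩
      ∑ʷ b n (λ z → ⟦ ⌊ (k ℕ.+ sum z) ℕ./ b ℕ.≟ j ⌋ ⟧) ∎))
      where
      open ≡-Reasoning
      count : ℕ
      count = length (filter (λ xs → inCarryWindow b k j xs Bool.≟ Bool.true) (tuples b n))

    ∑ʷ-1 : ∀ n (F : ℕ → ℕ) → ∑ʷ 1 n (F ∘ sum) ≡ F 0
    ∑ʷ-1 zero    F = refl
    ∑ʷ-1 (suc n) F = ∑ʷ-1 n F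

    b^r≢0 : ∀ r → ℕ.NonZero (b ℕ.^ r)
    b^r≢0 r = ℕ.m^n≢0 b r

    -- Row `0` alone is followed: it is what `sepTerm` reads, and multiplication from the right, as
    -- in `matPow`, expresses it through the previous row `0`. The new factor handles the leading
    -- base-`b` digit of the summands. At `r = 0` the only word consists of zeros, which gives the
    -- identity row.
    matPow-sum : ∀ n r j → matPow (suc n) (carriesP b (suc n)) r 0 j * ℕtoℚ ((b ℕ.^ r) ℕ.^ suc n) ≡
      ℕtoℚ (∑ʷ (b ℕ.^ r) (suc n) (λ x → ⟦ ⌊ (sum x ℕ./ (b ℕ.^ r)) {{b^r≢0 r}} ℕ.≟ j ⌋ ⟧))
    matPow-sum n zero j = begin
      idMat 0 j * ℕtoℚ (1 ℕ.^ suc n)  ≡⟨ cong (λ k → idMat 0 j * ℕtoℚ k) (ℕ.^-zeroˡ (suc n)) ⟩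
      idMat 0 j * 1ℚ                  ≡⟨ *-identityʳ _ ⟩
      idMat 0 j                       ≡⟨ diagonal ⟩
      ℕtoℚ ⟦ ⌊ 0 ℕ.≟ j ⌋ ⟧            ≡⟨ cong ℕtoℚ (sym (∑ʷ-1 (suc n) (λ s → ⟦ ⌊ s ℕ./ 1 ℕ.≟ j ⌋ ⟧))) ⟩
      ℕtoℚ (∑ʷ 1 (suc n) (λ x → ⟦ ⌊ sum x ℕ./ 1 ℕ.≟ j ⌋ ⟧)) ∎
      where
      open ≡-Reasoning
      diagonal : idMat 0 j ≡ ℕtoℚ ⟦ ⌊ 0 ℕ.≟ j ⌋ ⟧
      diagonal with 0 ℕ.≟ j
      ... | yes _ = refl
      ... | no  _ = refl
    matPow-sum n (suc r) j = begin
      Σ< (suc n) (λ k → M k * P k) * ℕtoℚ ((b ℕ.* B) ℕ.^ suc n)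
        ≡⟨ Σ<-cast (suc n) {f = λ k → M k * P k} (λ k → m k ℕ.* p k) entry ⟩
      ℕtoℚ (∑ (suc n) (λ k → m k ℕ.* p k))
        ≡⟨ cong ℕtoℚ (sym (carry-composition B b n {{b^r≢0 r}} {{_}} {{b^r≢0 (suc r)}} j)) ⟩
      ℕtoℚ (∑ʷ (b ℕ.* B) (suc n) (λ x → ⟦ ⌊ (sum x ℕ./ (b ℕ.* B)) {{b^r≢0 (suc r)}} ℕ.≟ j ⌋ ⟧)) ∎
      where
      open ≡-Reasoning
      B : ℕ
      B = b ℕ.^ r
      M P : ℕ → ℚ
      M k = matPow (suc n) (carriesP b (suc n)) r 0 k
      P k = carriesP b (suc n) k j
      m p : ℕ → ℕ
      m k = ∑ʷ B (suc n) (λ x → ⟦ ⌊ (sum x ℕ./ B) {{b^r≢0 r}} ℕ.≟ k ⌋ ⟧)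
      p k = ∑ʷ b (suc n) (λ z → ⟦ ⌊ (k ℕ.+ sum z) ℕ./ b ℕ.≟ j ⌋ ⟧)
      interchange : ∀ a c d e → a * c * (d * e) ≡ a * e * (c * d)
      interchange = solve-∀ ℚ-ring
      entry : ∀ k → M k * P k * ℕtoℚ ((b ℕ.* B) ℕ.^ suc n) ≡ ℕtoℚ (m k ℕ.* p k)
      entry k = begin
        M k * P k * ℕtoℚ ((b ℕ.* B) ℕ.^ suc n)                          ≡⟨ cong (λ d → M k * P k * ℕtoℚ d) (^-distribʳ-* (suc n) b B) ⟩
        M k * P k * ℕtoℚ (b ℕ.^ suc n ℕ.* B ℕ.^ suc n)                  ≡⟨ cong (M k * P k *_) (ℕtoℚ-* (b ℕ.^ suc n) (B ℕ.^ suc n)) ⟩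
        M k * P k * (ℕtoℚ (b ℕ.^ suc n) * ℕtoℚ (B ℕ.^ suc n))           ≡⟨ interchange (M k) (P k) _ _ ⟩
        M k * ℕtoℚ (B ℕ.^ suc n) * (P k * ℕtoℚ (b ℕ.^ suc n))           ≡⟨ cong₂ _*_ (matPow-sum n r k) (carriesP-cast (suc n) k j) ⟩
        ℕtoℚ (m k) * ℕtoℚ (p k)                                         ≡⟨ sym (ℕtoℚ-* (m k) (p k)) ⟩
        ℕtoℚ (m k ℕ.* p k)                                              ∎

    carryCount≡ : ∀ B n .{{_ : ℕ.NonZero B}} j → ∑ʷ B n (λ x → ⟦ ⌊ sum x ℕ./ B ℕ.≟ j ⌋ ⟧) ≡ carryCount B n j
    carryCount≡ B n j = trans (carries≡descents B n 0 (λ d → ⟦ ⌊ d ℕ.≟ j ⌋ ⟧) (ℕ.>-nonZero⁻¹ B))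
      (∑ʷ-cong B n λ w _ → cong (λ d → ⟦ ⌊ d ℕ.≟ j ⌋ ⟧) (descents-0∷ w))

    -- The quotient P^r(0,j)/π(j) for `suc n` summands; `sepTerm` is `1ℚ` minus it by definition.
    ratio : ℕ → ℕ → ℕ → ℚ
    ratio n r j = matPow (suc n) (carriesP b (suc n)) r 0 j * frac (suc n !) (eulerian (suc n) j)

    ratio-cast : ∀ n r j → j ℕ.≤ n → let B = b ℕ.^ r in
      ℕtoℚ (B ℕ.^ suc n ℕ.* eulerian (suc n) j) * ratio n r j ≡ ℕtoℚ (carryCount B (suc n) j ℕ.* suc n !)
    ratio-cast n r j j≤n = begin
      ℕtoℚ (D ℕ.* A) * (m * f)           ≡⟨ cong (_* (m * f)) (ℕtoℚ-* D A) ⟩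
      ℕtoℚ D * ℕtoℚ A * (m * f)          ≡⟨ interchange (ℕtoℚ D) (ℕtoℚ A) m f ⟩
      m * ℕtoℚ D * (f * ℕtoℚ A)          ≡⟨ cong₂ _*_ (trans (matPow-sum n r j) (cong ℕtoℚ (carryCount≡ B (suc n) {{b^r≢0 r}} j)))
                                                      (frac-*-cancel (suc n !) A {{ℕ.>-nonZero (eulerian-positive (suc n) j (ℕ.s≤s j≤n))}}) ⟩
      ℕtoℚ (carryCount B (suc n) j) * ℕtoℚ (suc n !) ≡⟨ sym (ℕtoℚ-* (carryCount B (suc n) j) (suc n !)) ⟩
      ℕtoℚ (carryCount B (suc n) j ℕ.* suc n !) ∎
      where
      open ≡-Reasoning
      B D A : ℕ
      B = b ℕ.^ r
      D = B ℕ.^ suc n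
      A = eulerian (suc n) j
      m f : ℚ
      m = matPow (suc n) (carriesP b (suc n)) r 0 j
      f = frac (suc n !) (eulerian (suc n) j)
      interchange : ∀ d a m f → d * a * (m * f) ≡ m * d * (f * a)
      interchange = solve-∀ ℚ-ring

    D*A-pos : ∀ n r j → j ℕ.≤ n → 0ℚ < ℕtoℚ ((b ℕ.^ r) ℕ.^ suc n ℕ.* eulerian (suc n) j)
    D*A-pos n r j j≤n = ℕtoℚ-pos _ {{ℕ.m*n≢0 ((b ℕ.^ r) ℕ.^ suc n) (eulerian (suc n) j)
      {{ℕ.m^n≢0 (b ℕ.^ r) (suc n) {{b^r≢0 r}}}} {{ℕ.>-nonZero (eulerian-positive (suc n) j (ℕ.s≤s j≤n))}}}}

    -- Both sides are the falling factorial of `B`, by `C-absorb`. For `n > B` both are zero: the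
    -- factor of index `B` vanishes, and so does `B C n`.
    fallingProduct-cast : ∀ B .{{_ : ℕ.NonZero B}} n →
      ℕtoℚ (B ℕ.^ n) * fallingProduct (frac 1 B) n ≡ ℕtoℚ ((B C n) ℕ.* n !)
    fallingProduct-cast B zero    = refl
    fallingProduct-cast B (suc n) = begin
      ℕtoℚ (B ℕ.* B ℕ.^ n) * (F * (1ℚ - ν * a))               ≡⟨ cong (_* (F * (1ℚ - ν * a))) (ℕtoℚ-* B (B ℕ.^ n)) ⟩
      β * ℕtoℚ (B ℕ.^ n) * (F * (1ℚ - ν * a))                 ≡⟨ regroup β (ℕtoℚ (B ℕ.^ n)) F ν a ⟩
      ℕtoℚ (B ℕ.^ n) * F * (β - ν * (a * β))                  ≡⟨ cong₂ (λ p q → p * (β - ν * q)) (fallingProduct-cast B n) (frac-*-cancel 1 B) ⟩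
      c * (β - ν * 1ℚ)                                        ≡⟨ expand c β ν ⟩
      β * c - ν * c                                           ≡⟨ cong (_- ν * c) (sym absorb) ⟩
      (c′ + ν * c) - ν * c                                    ≡⟨ cancel c′ (ν * c) ⟩
      c′                                                      ∎
      where
      open ≡-Reasoning
      F ν a β c c′ : ℚ
      F = fallingProduct (frac 1 B) n
      ν = ℕtoℚ n
      a = frac 1 B
      β = ℕtoℚ B
      c = ℕtoℚ ((B C n) ℕ.* n !)
      c′ = ℕtoℚ ((B C suc n) ℕ.* suc n !)
      regroup : ∀ β d F ν a → β * d * (F * (1ℚ - ν * a)) ≡ d * F * (β - ν * (a * β))
      regroup = solve-∀ ℚ-ring
      expand : ∀ c β ν → c * (β - ν * 1ℚ) ≡ β * c - ν * c
      expand = solve-∀ ℚ-ring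
      cancel : ∀ x y → (x + y) - y ≡ x
      cancel = solve-∀ ℚ-ring
      absorb-ℕ : (B C suc n) ℕ.* suc n ! ℕ.+ n ℕ.* ((B C n) ℕ.* n !) ≡ B ℕ.* ((B C n) ℕ.* n !)
      absorb-ℕ = begin
        (B C suc n) ℕ.* (suc n ℕ.* n !) ℕ.+ n ℕ.* ((B C n) ℕ.* n !)
          ≡⟨ cong₂ ℕ._+_ (trans (sym (ℕ.*-assoc (B C suc n) (suc n) (n !))) (cong (ℕ._* n !) (ℕ.*-comm (B C suc n) (suc n)))) (sym (ℕ.*-assoc n (B C n) (n !))) ⟩
        suc n ℕ.* (B C suc n) ℕ.* n ! ℕ.+ n ℕ.* (B C n) ℕ.* n !
          ≡⟨ sym (ℕ.*-distribʳ-+ (n !) (suc n ℕ.* (B C suc n)) (n ℕ.* (B C n))) ⟩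
        (suc n ℕ.* (B C suc n) ℕ.+ n ℕ.* (B C n)) ℕ.* n !
          ≡⟨ cong (ℕ._* n !) (C-absorb B n) ⟩
        B ℕ.* (B C n) ℕ.* n !
          ≡⟨ ℕ.*-assoc B (B C n) (n !) ⟩
        B ℕ.* ((B C n) ℕ.* n !) ∎
      absorb : c′ + ν * c ≡ β * c
      absorb = begin
        c′ + ν * c                                                            ≡⟨ cong (c′ +_) (sym (ℕtoℚ-* n ((B C n) ℕ.* n !))) ⟩
        c′ + ℕtoℚ (n ℕ.* ((B C n) ℕ.* n !))                                   ≡⟨ sym (ℕtoℚ-+ ((B C suc n) ℕ.* suc n !) (n ℕ.* ((B C n) ℕ.* n !))) ⟩
        ℕtoℚ ((B C suc n) ℕ.* suc n ! ℕ.+ n ℕ.* ((B C n) ℕ.* n !))            ≡⟨ cong ℕtoℚ absorb-ℕ ⟩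
        ℕtoℚ (B ℕ.* ((B C n) ℕ.* n !))                                        ≡⟨ ℕtoℚ-* B ((B C n) ℕ.* n !) ⟩
        β * c                                                                 ∎

    -- The maximum in the separation distance

    module _ (n r : ℕ) where
      private
        B D : ℕ
        B = b ℕ.^ r
        D = B ℕ.^ suc n
        a : ℚ
        a = frac 1 B

      scaled-fallingProduct : ∀ j → ℕtoℚ (D ℕ.* eulerian (suc n) j) * fallingProduct a (suc n) ≡
        ℕtoℚ ((B C suc n) ℕ.* eulerian (suc n) j ℕ.* suc n !)
      scaled-fallingProduct j = begin
        ℕtoℚ (D ℕ.* A) * F                     ≡⟨ cong (_* F) (ℕtoℚ-* D A) ⟩
        ℕtoℚ D * ℕtoℚ A * F                    ≡⟨ swap (ℕtoℚ D) (ℕtoℚ A) F ⟩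
        ℕtoℚ D * F * ℕtoℚ A                    ≡⟨ cong (_* ℕtoℚ A) (fallingProduct-cast B {{b^r≢0 r}} (suc n)) ⟩
        ℕtoℚ ((B C suc n) ℕ.* suc n !) * ℕtoℚ A ≡⟨ sym (ℕtoℚ-* ((B C suc n) ℕ.* suc n !) A) ⟩
        ℕtoℚ ((B C suc n) ℕ.* suc n ! ℕ.* A)   ≡⟨ cong ℕtoℚ (trans (ℕ.*-assoc (B C suc n) (suc n !) A) (trans (cong ((B C suc n) ℕ.*_) (ℕ.*-comm (suc n !) A)) (sym (ℕ.*-assoc (B C suc n) A (suc n !))))) ⟩
        ℕtoℚ ((B C suc n) ℕ.* A ℕ.* suc n !)   ∎
        where
        open ≡-Reasoning
        A : ℕ
        A = eulerian (suc n) j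
        F : ℚ
        F = fallingProduct a (suc n)
        swap : ∀ d x f → d * x * f ≡ d * f * x
        swap = solve-∀ ℚ-ring

      fallingProduct≤ratio : ∀ j → j ℕ.≤ n → fallingProduct a (suc n) ≤ ratio n r j
      fallingProduct≤ratio j j≤n = *-cancelˡ (D*A-pos n r j j≤n) (subst₂ _≤_ (sym (scaled-fallingProduct j)) (sym (ratio-cast n r j j≤n))
        (ℕtoℚ-mono (ℕ.*-monoˡ-≤ (suc n !) (carryCount-≥ B (suc n) j))))

      ratio-top : ratio n r n ≡ fallingProduct a (suc n)
      ratio-top = *-cancelˡ-≡ (D*A-pos n r n ℕ.≤-refl) (trans (ratio-cast n r n ℕ.≤-refl)
        (trans (cong (λ k → ℕtoℚ (k ℕ.* suc n !)) (carryCount-top B n)) (sym (scaled-fallingProduct n))))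

      sepTerm≤top : ∀ j → j ℕ.≤ n → sepTerm b (suc n) r j ≤ sepTerm b (suc n) r n
      sepTerm≤top j j≤n = +-monoʳ-≤ 1ℚ (neg-antimono-≤ (subst (_≤ ratio n r j) (sym ratio-top) (fallingProduct≤ratio j j≤n)))

      sep≡ : sep b (suc n) r ≡ 1ℚ - fallingProduct a (suc n)
      sep≡ = trans (≤-antisym (upper (suc n) id (λ k k≤n → ℕ.s≤s⁻¹ k≤n)) (lower (suc n) id n ℕ.≤-refl)) (cong (λ q → 1ℚ - q) ratio-top)
        where
        t : ℕ → ℚ
        t = sepTerm b (suc n) r
        -- The seed `t 0` of the fold is itself one of the terms and so cannot exceed `t n`; `g`
        -- accounts for the shifted indices in the tail of `upTo`.
        upper : ∀ m (g : ℕ → ℕ) → (∀ k → k ℕ.< m → g k ℕ.≤ n) → foldr (λ j acc → t j ⊔ acc) (t 0) (applyUpTo g m) ≤ t n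
        upper zero    g h = sepTerm≤top 0 ℕ.z≤n
        upper (suc m) g h = ⊔-lub (sepTerm≤top (g 0) (h 0 (ℕ.s≤s ℕ.z≤n))) (upper m (g ∘ suc) (λ k k<m → h (suc k) (ℕ.s≤s k<m)))
        lower : ∀ m (g : ℕ → ℕ) k → k ℕ.< m → t (g k) ≤ foldr (λ j acc → t j ⊔ acc) (t 0) (applyUpTo g m)
        lower (suc m) g zero    _         = p≤p⊔q (t (g 0)) _
        lower (suc m) g (suc k) (ℕ.s≤s h) = ≤-trans (lower m (g ∘ suc) k h) (p≤q⊔p (t (g 0)) _)

  -- The scaling `b ^ r = n² c`

  invTwice-inverse : ∀ c → 0ℚ < c → 0ℚ ≤ invTwice c × invTwice c * (c + c) ≡ 1ℚ
  invTwice-inverse c@(mkℚ (ℤ.+ zero)    _ _) (*<* (ℤ.+<+ ()))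
  invTwice-inverse c@(mkℚ ℤ.-[1+ _ ] _ _) (*<* ())
  -- Both denominators are cleared: `2p` belongs to `invTwice c`, and `suc d` to `c`.
  invTwice-inverse c@(mkℚ (ℤ.+ suc p) d _) _ = frac-nonNeg (suc d) 2p , *-cancelˡ-≡ (ℕtoℚ-pos 2p) (*-cancelˡ-≡ (ℕtoℚ-pos (suc d)) (begin
    δ * (ℕtoℚ 2p * (x * (c + c)))         ≡⟨ regroup δ (ℕtoℚ 2p) x c ⟩
    x * ℕtoℚ 2p * (c * δ + c * δ)         ≡⟨ cong₂ (λ u v → u * (v + v)) (frac-*-cancel (suc d) 2p) c*δ ⟩
    δ * (ℕtoℚ (suc p) + ℕtoℚ (suc p))     ≡⟨ cong (δ *_) (trans (sym (ℕtoℚ-+ (suc p) (suc p))) (cong ℕtoℚ (cong (suc p ℕ.+_) (sym (ℕ.+-identityʳ (suc p)))))) ⟩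
    δ * ℕtoℚ 2p                           ≡⟨ cong (δ *_) (sym (*-identityʳ (ℕtoℚ 2p))) ⟩
    δ * (ℕtoℚ 2p * 1ℚ)                    ∎))
    where
    open ≡-Reasoning
    2p : ℕ
    2p = 2 ℕ.* suc p
    x δ : ℚ
    x = invTwice c
    δ = ℕtoℚ (suc d)
    c*δ : c * δ ≡ ℕtoℚ (suc p)
    c*δ = trans (cong (_* δ) (sym (↥p/↧p≡p c))) (frac-*-cancel (suc p) (suc d))
    regroup : ∀ δ m x c → δ * (m * (x * (c + c))) ≡ x * m * (c * δ + c * δ)
    regroup = solve-∀ ℚ-ring

  sep-limit : ∀ b .{{_ : ℕ.NonZero b}} c → 0ℚ < c → ∀ ε → 0ℚ < ε → Σ ℕ λ N → ∀ n → N ℕ.≤ n → 2 ℕ.≤ n → ∀ r →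
    ℕtoℚ (b ℕ.^ r) ≡ ℕtoℚ (n ℕ.* n) * c → ∀ M → N ℕ.≤ M →
    ∣ sep b n r - (1ℚ - expPartial M (- invTwice c)) ∣ < ε
  sep-limit b c 0<c ε 0<ε = proj₁ limit , close
    where
    x : ℚ
    x = invTwice c
    limit = fallingProduct-limit {x} {ε} (proj₁ (invTwice-inverse c 0<c)) 0<ε
    close : ∀ n → proj₁ limit ℕ.≤ n → 2 ℕ.≤ n → ∀ r → ℕtoℚ (b ℕ.^ r) ≡ ℕtoℚ (n ℕ.* n) * c → ∀ M → proj₁ limit ℕ.≤ M →
      ∣ sep b n r - (1ℚ - expPartial M (- x)) ∣ < ε
    close n@(suc n-1) N≤n 2≤n r b^r≡ M N≤M = subst (_< ε) (sym ∣difference∣)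
      (proj₂ limit n a N≤n 2≤n (frac-nonNeg 1 (b ℕ.^ r)) 2x M N≤M)
      where
      open ≡-Reasoning
      a F f : ℚ
      a = frac 1 (b ℕ.^ r)
      F = fallingProduct a n
      f = expPartial M (- x)
      reverse : ∀ F f → (1ℚ - F) - (1ℚ - f) ≡ - (F - f)
      reverse = solve-∀ ℚ-ring
      ∣difference∣ : ∣ sep b n r - (1ℚ - f) ∣ ≡ ∣ F - f ∣
      ∣difference∣ = begin
        ∣ sep b n r - (1ℚ - f) ∣     ≡⟨ cong (λ q → ∣ q - (1ℚ - f) ∣) (sep≡ b n-1 r) ⟩
        ∣ (1ℚ - F) - (1ℚ - f) ∣      ≡⟨ cong ∣_∣ (reverse F f) ⟩
        ∣ - (F - f) ∣                ≡⟨ ∣-p∣≡∣p∣ (F - f) ⟩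
        ∣ F - f ∣                    ∎
      distribute : ∀ x a ν c → (x + x) * (a * (ν * ν * c)) ≡ x * (c + c) * (ν * ν * a)
      distribute = solve-∀ ℚ-ring
      -- This is 2x = n²/B: the factor `a * B = 1` is inserted, `B` is replaced by n² c, and
      -- `x * (c + c) = 1` removes `c`.
      2x : x + x ≡ ℕtoℚ n * ℕtoℚ n * a
      2x = begin
        x + x                                        ≡⟨ sym (*-identityʳ (x + x)) ⟩
        (x + x) * 1ℚ                                 ≡⟨ cong ((x + x) *_) (sym (frac-*-cancel 1 (b ℕ.^ r) {{ℕ.m^n≢0 b r}})) ⟩
        (x + x) * (a * ℕtoℚ (b ℕ.^ r))               ≡⟨ cong (λ q → (x + x) * (a * q)) b^r≡ ⟩
        (x + x) * (a * (ℕtoℚ (n ℕ.* n) * c))         ≡⟨ cong (λ q → (x + x) * (a * (q * c))) (ℕtoℚ-* n n) ⟩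
        (x + x) * (a * (ℕtoℚ n * ℕtoℚ n * c))        ≡⟨ distribute x a (ℕtoℚ n) c ⟩
        x * (c + c) * (ℕtoℚ n * ℕtoℚ n * a)          ≡⟨ cong (_* (ℕtoℚ n * ℕtoℚ n * a)) (proj₂ (invTwice-inverse c 0<c)) ⟩
        1ℚ * (ℕtoℚ n * ℕtoℚ n * a)                   ≡⟨ *-identityˡ _ ⟩
        ℕtoℚ n * ℕtoℚ n * a                          ∎

open import Data.Nat using (ℕ; _≤_; _<_; _∸_; _^_; _*_)
open import Data.Rational using (ℚ; 0ℚ; 1ℚ; _-_; ∣_∣; -_) renaming (_≤_ to _≤ℚ_; _<_ to _<ℚ_; _*_ to _*ℚ_)
open import Data.Product using (_×_; Σ)
open import Relation.Binary.PropositionalEquality using (_≡_)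
open import Data.Nat using (zero; suc; s≤s⁻¹)
open import Data.Product using (_,_)

theorem4p3 : (b : ℕ) → 2 ≤ b →
    ((n : ℕ) → 2 ≤ n → (r j : ℕ) → j < n →
    sepTerm b n r j ≤ℚ sepTerm b n r (n ∸ 1))
    ×
    ((c : ℚ) → 0ℚ <ℚ c →
    (ε : ℚ) → 0ℚ <ℚ ε →
    Σ ℕ λ N → (n : ℕ) → N ≤ n → 2 ≤ n → (r : ℕ) →
    ℕtoℚ (b ^ r) ≡ ℕtoℚ (n * n) *ℚ c →
    (M : ℕ) → N ≤ M →
    ∣ sep b n r - (1ℚ - expPartial M (- invTwice c)) ∣ <ℚ ε)
theorem4p3 b@(suc _) _ = maximum , SeparationDistance.sep-limit b
  where
  maximum : (n : ℕ) → 2 ≤ n → (r j : ℕ) → j < n → sepTerm b n r j ≤ℚ sepTerm b n r (n ∸ 1)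
  maximum (suc n) _ r j j<n = SeparationDistance.sepTerm≤top b n r j (s≤s⁻¹ j<n)
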